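{- Let $\mathcal{R}$ be a finite TRS such that there exists a proof tree $\mathcal{T}$ of $\mathcal{R}$ in which every edge label is a reduction pair processor, a dependency graph processor, or a subterm criterion processor (so $\mathcal{R}$ is terminating). Suppose that some reduction pair function $g$ of $\mathcal{R}$ with respect to $\mathcal{T}$ is multiply recursive. Then the derivational complexity function $\mathrm{dc}_{\mathcal{R}}$ is bounded from above by a multiply recursive function. Furthermore, this upper bound is tight: for every multiply recursive function $f$ there exists a finite TRS $\mathcal{R}'$ admitting such a proof tree with a multiply recursive reduction pair function, and such that $\mathrm{dc}_{\mathcal{R}'}$ majorises $f$.
   Context: Terms are built over a finite signature $\mathcal{F}$ (containing at least one constant) and a countably infinite set of variables; a (finite) TRS $\mathcal{R}$ is a finite set of rewrite rules $l\to r$ ($l$ not a variable, variables of $r$ occur in $l$); defined symbols are root symbols of left-hand sides. $\to_{\mathcal{R}}$ is the rewrite relation, $\unrhd$ ($\rhd$) the (proper) superterm relation, $|t|$ the size (number of symbols) of $t$. For rule sets $\mathcal{P},\mathcal{S}$, the relative rewrite relation is $\to_{\mathcal{P}/\mathcal{S}}={\to_{\mathcal{S}}^*}\cdot{\to_{\mathcal{P}}}\cdot{\to_{\mathcal{S}}^*}$, and $\mathrm{NF}(\mathcal{P}/\mathcal{S})$ its normal forms. For a finitely branching well-founded relation $\to$, $\mathrm{dh}(s,\to)=\max\{n\mid \exists t\, s\to^n t\}$; $\mathrm{dc}_{\mathcal{R}}(n)=\max\{\mathrm{dh}(t,\to_{\mathcal{R}})\mid |t|\le n\}$. Dependency pairs: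 for each defined $f$ of arity $n$ take a fresh $n$-ary symbol $f^\sharp$; $t^\sharp=t$ for a variable $t$ and $t^\sharp=f^\sharp(t_1,\dots,t_n)$ for $t=f(t_1,\dots,t_n)$. $\mathrm{DP}(\mathcal{R})=\{l^\sharp\to u^\sharp\mid l\to r\in\mathcal{R},\ u\unlhd r,\ u\not\lhd l,\ \text{root of } u \text{ defined}\}$. A DP problem is a pair $(\mathcal{P},\mathcal{R})$ with $\mathcal{P}\subseteq\mathrm{DP}(\mathcal{R})$. DP processors map DP problems to sets of DP problems: (RP) Given a reduction pair $(\succcurlyeq,\succ)$ ($\succcurlyeq$ a preorder closed under contexts and substitutions, $\succ$ a well-founded order closed under substitutions, ${\succcurlyeq}\cdot{\succ}\cdot{\succcurlyeq}\subseteq{\succ}$): $\Phi((\mathcal{P},\mathcal{R}))=\{(\mathcal{P}',\mathcal{R})\}$ if $\mathcal{P}'\cup\mathcal{R}\subseteq{\succcurlyeq}$ and $\mathcal{P}\setminus\mathcal{P}'\subseteq{\succ}$, and $\{(\mathcal{P},\mathcal{R})\}$ otherwise. (DG) The dependency graph $\mathrm{DG}(\mathcal{P},\mathcal{R})$ has nodes $\mathcal{P}$ and an edge from $s\to t$ to $u\to v$ iff $t\sigma\to_{\mathcal{R}}^* u\tau$ for some substitutions $\sigma,\tau$. An SCC is a maximal set of nodes such that any two are connected by a path; it is trivial if it is a single node whose only path to itself is the empty path, nontrivial otherwise. $\Phi((\mathcal{P},\mathcal{R}))=\{(\mathcal{P}',\mathcal{R})\mid \mathcal{P}' \text{ a nontrivial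 SCC of } \mathrm{DG}(\mathcal{P},\mathcal{R})\}$. (SC) A simple projection $\pi$ assigns to each $f^\sharp$ of arity $n$ an index $1\le\pi(f^\sharp)\le n$, with $\pi(f^\sharp(t_1,\dots,t_n))=t_{\pi(f^\sharp)}$. $\Phi((\mathcal{P},\mathcal{R}))=\{(\mathcal{P}',\mathcal{R})\}$ if $\pi(s)\unrhd\pi(t)$ for all $s\to t\in\mathcal{P}'$ and $\pi(s)\rhd\pi(t)$ for all $s\to t\in\mathcal{P}\setminus\mathcal{P}'$, and $\{(\mathcal{P},\mathcal{R})\}$ otherwise. A proof tree of $\mathcal{R}$ is a tree whose nodes are DP problems, whose root is $(\mathrm{DP}(\mathcal{R}),\mathcal{R})$, whose leaves are of the form $(\varnothing,\mathcal{R})$, and such that for each inner node $(\mathcal{P},\mathcal{R})$ there is a processor $\Phi$ such that every element of $\Phi((\mathcal{P},\mathcal{R}))$ is a child of it, the edges being labelled by $\Phi$. Reduction pair function: let $k$ be the maximum number of SCCs (trivial and nontrivial) in any dependency graph used by a DG-processor in $\mathcal{T}$. A monotone $g:\mathbb{N}\to\mathbb{N}$ is a reduction pair function of $\mathcal{R}$ w.r.t. $\mathcal{T}$ if for all $n$, $g(n)\ge k$ and $g(n)\ge \mathrm{dh}(t^\sharp,\to_{(\mathcal{P}\setminus\mathcal{Q})/(\mathcal{R}\cup\mathcal{Q})})$ for every edge of $\mathcal{T}$ from $(\mathcal{P},\mathcal{R})$ to $(\mathcal{Q},\mathcal{R})$ labelled by a reduction pair processor and every term $t$ with $|t|\le n$.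 Multiply recursive functions: the smallest class of functions over $\mathbb{N}$ containing the zero functions, successor, projections and all $k$-ary Ackermann functions $A_k$ ($k\ge2$), closed under composition and primitive recursion, where $A_k(0,\dots,0,x_k)=x_k+1$, $A_k(x_1,\dots,x_{k-2},x_{k-1}+1,0)=A_k(x_1,\dots,x_{k-1},1)$, $A_k(x_1,\dots,x_{k-2},x_{k-1}+1,x_k+1)=A_k(x_1,\dots,x_{k-1},A_k(x_1,\dots,x_{k-2},x_{k-1}+1,x_k))$, $A_k(x_1,\dots,x_{i-1},x_i+1,0,\dots,0,x_k)=A_k(x_1,\dots,x_i,x_k,0,\dots,0,x_k)$. -}

module Defs where

open import Level using (Level) renaming (suc to lsuc)
open import Data.Nat using (ℕ; zero; suc; _≤_; _+_)
open import Data.Fin using (Fin; _≟_)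
open import Data.Vec using (Vec; []; _∷_; lookup; _[_]≔_; toList)
open import Data.List using (List; []; _∷_; _++_; [_]; replicate)
open import Data.Bool.ListAction using (any)
open import Data.List.Membership.Propositional using (_∈_)
open import Data.List.Relation.Unary.All using (All)
open import Data.Bool using (Bool; true; false; T)
open import Data.Sum using (_⊎_; inj₁; inj₂)
open import Data.Product using (Σ; _×_; _,_; proj₁; proj₂)
open import Relation.Nullary using (¬_)
open import Relation.Nullary.Decidable using (⌊_⌋)
open import Relation.Binary.PropositionalEquality using (_≡_)
open import Relation.Binary.Construct.Closure.ReflexiveTransitive using (Star)
open import Induction.WellFounded using (WellFounded)

data Chain {A : Set} (E : A → A → Set) : ℕ → A → A → Set where
  done : ∀ {a} → Chain E 0 a a
  step : ∀ {k a b c} → E a b → Chain E k b c → Chain E (suc k) a c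

DhBound : {A : Set} → (A → A → Set) → A → ℕ → Set
DhBound E t m = ∀ k u → Chain E k t u → k ≤ m

data Plus {A : Set} (E : A → A → Set) : A → A → Set where
  one  : ∀ {a b} → E a b → Plus E a b
  _∷⁺_ : ∀ {a b c} → E a b → Plus E b c → Plus E a c

-- Graph of the Ackermann functions A_k, k = length of the argument list (k ≥ 2).
data AckR : List ℕ → ℕ → Set where
  a1 : ∀ n x → AckR (replicate (suc n) 0 ++ [ x ]) (suc x)
  a2 : ∀ xs x r → AckR (xs ++ x ∷ 1 ∷ []) r → AckR (xs ++ suc x ∷ 0 ∷ []) r
  a3 : ∀ xs x y r s → AckR (xs ++ suc x ∷ y ∷ []) r → AckR (xs ++ x ∷ r ∷ []) s
     → AckR (xs ++ suc x ∷ suc y ∷ []) s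
  a4 : ∀ xs x j y r → AckR (xs ++ x ∷ y ∷ (replicate j 0 ++ [ y ])) r
     → AckR (xs ++ suc x ∷ (replicate (suc j) 0 ++ [ y ])) r

data MRC : ℕ → Set where
  zeroF : ∀ k → MRC k
  succF : MRC 1
  projF : ∀ {k} → Fin k → MRC k
  ackF  : ∀ k → MRC (2 + k)
  compF : ∀ {k m} → MRC m → Vec (MRC k) m → MRC k
  precF : ∀ {k} → MRC k → MRC (2 + k) → MRC (suc k)

mutual
  data Eval : ∀ {k} → MRC k → Vec ℕ k → ℕ → Set where
    ezero : ∀ {k xs} → Eval (zeroF k) xs 0
    esucc : ∀ {x} → Eval succF (x ∷ []) (suc x)
    eproj : ∀ {k xs} (i : Fin k) → Eval (projF i) xs (lookup xs i)
    eack  : ∀ {k xs r} → AckR (toList xs) r → Eval (ackF k) xs r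
    ecomp : ∀ {k m} {h : MRC m} {gs : Vec (MRC k) m} {xs ys r}
          → EvalAll gs xs ys → Eval h ys r → Eval (compF h gs) xs r
    eprec0 : ∀ {k} {g : MRC k} {h xs r} → Eval g xs r → Eval (precF g h) (0 ∷ xs) r
    eprecS : ∀ {k} {g : MRC k} {h y xs r s}
           → Eval (precF g h) (y ∷ xs) r → Eval h (y ∷ r ∷ xs) s
           → Eval (precF g h) (suc y ∷ xs) s

  data EvalAll {k : ℕ} : ∀ {m} → Vec (MRC k) m → Vec ℕ k → Vec ℕ m → Set where
    [] : ∀ {xs} → EvalAll [] xs []
    _∷_ : ∀ {m g xs y} {gs : Vec (MRC k) m} {ys}
        → Eval g xs y → EvalAll gs xs ys → EvalAll (g ∷ gs) xs (y ∷ ys)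

MultRec : (ℕ → ℕ) → Set
MultRec f = Σ (MRC 1) λ c → ∀ n → Eval c (n ∷ []) (f n)

Monotone : (ℕ → ℕ) → Set
Monotone g = ∀ m n → m ≤ n → g m ≤ g n

module Terms (Sym : Set) (ar : Sym → ℕ) where

  data Term : Set where
    var : ℕ → Term
    fun : (f : Sym) → Vec Term (ar f) → Term

  Subst : Set
  Subst = ℕ → Term

  mutual
    sub : Subst → Term → Term
    sub σ (var x)    = σ x
    sub σ (fun f ts) = fun f (subs σ ts)

    subs : ∀ {n} → Subst → Vec Term n → Vec Term n
    subs σ []       = []
    subs σ (t ∷ ts) = sub σ t ∷ subs σ ts

  mutual
    size : Term → ℕ
    size (var _)    = 1
    size (fun f ts) = suc (sizes ts)

    sizes : ∀ {n} → Vec Term n → ℕ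
    sizes []       = 0
    sizes (t ∷ ts) = size t + sizes ts

  data _⊵_ : Term → Term → Set where
    ⊵-refl : ∀ {t} → t ⊵ t
    ⊵-arg  : ∀ {f ts u} (i : Fin (ar f)) → lookup ts i ⊵ u → fun f ts ⊵ u

  data _▷_ : Term → Term → Set where
    ▷-arg : ∀ {f ts u} (i : Fin (ar f)) → lookup ts i ⊵ u → fun f ts ▷ u

  record Rule : Set where
    constructor _⟶_
    field
      lhs rhs : Term
  open Rule public

  WellFormed : Rule → Set
  WellFormed ρ = (∀ x → ¬ (lhs ρ ≡ var x)) × (∀ x → rhs ρ ⊵ var x → lhs ρ ⊵ var x)

  data Step (R : Rule → Set) : Term → Term → Set where
    rootStep : ∀ {ρ} → R ρ → (σ : Subst) → Step R (sub σ (lhs ρ)) (sub σ (rhs ρ))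
    argStep  : ∀ {f ts t'} (i : Fin (ar f)) → Step R (lookup ts i) t'
             → Step R (fun f ts) (fun f (ts [ i ]≔ t'))

record TRS : Set where
  field
    N     : ℕ
    ar    : Fin N → ℕ
    const : Σ (Fin N) λ c → ar c ≡ 0
    rules : List (Terms.Rule (Fin N) ar)
    wf    : All (Terms.WellFormed (Fin N) ar) rules

module DPF (S : TRS) where
  open TRS S public
  open Terms (Fin N) ar public

  -- extended signature F ∪ F♯ : inj₁ f = f, inj₂ f = f♯
  ar♯ : Fin N ⊎ Fin N → ℕ
  ar♯ (inj₁ f) = ar f
  ar♯ (inj₂ f) = ar f

  module ♯ = Terms (Fin N ⊎ Fin N) ar♯

  Term♯ : Set
  Term♯ = ♯.Term

  Rule♯ : Set
  Rule♯ = ♯.Rule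

  mutual
    emb : Term → Term♯
    emb (var x)    = ♯.var x
    emb (fun f ts) = ♯.fun (inj₁ f) (embs ts)

    embs : ∀ {n} → Vec Term n → Vec Term♯ n
    embs []       = []
    embs (t ∷ ts) = emb t ∷ embs ts

  sharp : Term → Term♯
  sharp (var x)    = ♯.var x
  sharp (fun f ts) = ♯.fun (inj₂ f) (embs ts)

  rootIs : Fin N → Term → Bool
  rootIs f (var _)   = false
  rootIs f (fun g _) = ⌊ f ≟ g ⌋

  Defined : Fin N → Set
  Defined f = T (any (λ ρ → rootIs f (lhs ρ)) rules)

  DefRoot : Term → Set
  DefRoot u = Σ (Fin N) λ f → Σ (Vec Term (ar f)) λ ts → (u ≡ fun f ts) × Defined f

  Pred♯ : Set₁
  Pred♯ = Rule♯ → Set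

  IsDP : Pred♯
  IsDP ρ♯ = Σ Rule λ ρ → (ρ ∈ rules) × Σ Term λ u →
              (rhs ρ ⊵ u) × (¬ (lhs ρ ▷ u)) × DefRoot u ×
              (ρ♯ ≡ (sharp (lhs ρ) ♯.⟶ sharp u))

  R♯ : Pred♯
  R♯ ρ♯ = Σ Rule λ ρ → (ρ ∈ rules) × (ρ♯ ≡ (emb (lhs ρ) ♯.⟶ emb (rhs ρ)))

  _⊆_ : Pred♯ → Pred♯ → Set
  P ⊆ Q = ∀ ρ → P ρ → Q ρ

  _∖_ : Pred♯ → Pred♯ → Pred♯
  (P ∖ Q) ρ = P ρ × ¬ Q ρ

  _∪_ : Pred♯ → Pred♯ → Pred♯
  (P ∪ Q) ρ = P ρ ⊎ Q ρ

  Rel : Pred♯ → Pred♯ → Term♯ → Term♯ → Set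
  Rel P Q s t = Σ Term♯ λ s' → Σ Term♯ λ t' →
                Star (♯.Step Q) s s' × ♯.Step P s' t' × Star (♯.Step Q) t' t

  Node : Pred♯ → Set
  Node P = Σ Rule♯ P

  Edge : (P : Pred♯) → Node P → Node P → Set
  Edge P x y = Σ ♯.Subst λ σ → Σ ♯.Subst λ τ →
               Star (♯.Step R♯) (♯.sub σ (♯.rhs (proj₁ x))) (♯.sub τ (♯.lhs (proj₁ y)))

  SameSCC : (P : Pred♯) → Node P → Node P → Set
  SameSCC P x y = Star (Edge P) x y × Star (Edge P) y x

  NontrivSCC : Pred♯ → Pred♯ → Set
  NontrivSCC P Q = Σ (Node P) λ x → Plus (Edge P) x x ×
                   ((∀ ρ → Q ρ → Σ (P ρ) λ p → SameSCC P x (ρ , p)) ×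
                    (∀ ρ (p : P ρ) → SameSCC P x (ρ , p) → Q ρ))

  SCCsAtMost : Pred♯ → ℕ → Set
  SCCsAtMost P m = Σ (Node P → Fin m) λ c →
                   (∀ x y → SameSCC P x y → c x ≡ c y) ×
                   (∀ x y → c x ≡ c y → SameSCC P x y)

  record RedPair : Set₁ where
    field
      _≽_ _≻_  : Term♯ → Term♯ → Set
      ≽-refl   : ∀ {s} → s ≽ s
      ≽-trans  : ∀ {s t u} → s ≽ t → t ≽ u → s ≽ u
      ≽-ctx    : ∀ {f} (ts : Vec Term♯ (ar♯ f)) (i : Fin (ar♯ f)) {s t}
               → s ≽ t → ♯.fun f (ts [ i ]≔ s) ≽ ♯.fun f (ts [ i ]≔ t)
      ≽-subst  : ∀ {s t} (σ : ♯.Subst) → s ≽ t → ♯.sub σ s ≽ ♯.sub σ t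
      ≻-trans  : ∀ {s t u} → s ≻ t → t ≻ u → s ≻ u
      ≻-wf     : WellFounded (λ t s → s ≻ t)
      ≻-subst  : ∀ {s t} (σ : ♯.Subst) → s ≻ t → ♯.sub σ s ≻ ♯.sub σ t
      compat   : ∀ {s t u v} → s ≽ t → t ≻ u → u ≽ v → s ≻ v

  Projection : Set
  Projection = (f : Fin N) → Defined f → Fin (ar f)

  ProjOf : Projection → Term♯ → Term♯ → Set
  ProjOf π s u = Σ (Fin N) λ f → Σ (Vec Term♯ (ar f)) λ ss →
                 (s ≡ ♯.fun (inj₂ f) ss) × Σ (Defined f) λ d → u ≡ lookup ss (π f d)

  data PT : Pred♯ → Set₁ where
    leaf   : ∀ {P} → (∀ ρ → ¬ P ρ) → PT P
    rpStep : ∀ {P} (rp : RedPair) (Q : Pred♯) → Q ⊆ IsDP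
           → (∀ ρ → Q ρ → RedPair._≽_ rp (♯.lhs ρ) (♯.rhs ρ))
           → (∀ ρ → R♯ ρ → RedPair._≽_ rp (♯.lhs ρ) (♯.rhs ρ))
           → (∀ ρ → (P ∖ Q) ρ → RedPair._≻_ rp (♯.lhs ρ) (♯.rhs ρ))
           → PT Q → PT P
    dgStep : ∀ {P} → ((Q : Pred♯) → NontrivSCC P Q → PT Q) → PT P
    scStep : ∀ {P} (π : Projection) (Q : Pred♯) → Q ⊆ IsDP
           → (∀ ρ → Q ρ → ∀ a b → ProjOf π (♯.lhs ρ) a → ProjOf π (♯.rhs ρ) b → a ♯.⊵ b)
           → (∀ ρ → (P ∖ Q) ρ → ∀ a b → ProjOf π (♯.lhs ρ) a → ProjOf π (♯.rhs ρ) b → a ♯.▷ b)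
           → PT Q → PT P

  ProofTree : Set₁
  ProofTree = PT IsDP

  data IsRPF (g : ℕ → ℕ) : ∀ {P : Pred♯} → PT P → Set₁ where
    fLeaf : ∀ {P : Pred♯} {e : ∀ ρ → ¬ P ρ} → IsRPF g (leaf e)
    fRP   : ∀ {P : Pred♯} {rp : RedPair} {Q qd h₁ h₂ h₃} {t : PT Q}
          → (∀ n (s : Term) → size s ≤ n → DhBound (Rel (P ∖ Q) (R♯ ∪ Q)) (sharp s) (g n))
          → IsRPF g t → IsRPF g (rpStep {P} rp Q qd h₁ h₂ h₃ t)
    fDG   : ∀ {P} {k : (Q : Pred♯) → NontrivSCC P Q → PT Q}
          → (∀ n → SCCsAtMost P (g n))
          → (∀ Q (h : NontrivSCC P Q) → IsRPF g (k Q h))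
          → IsRPF g (dgStep k)
    fSC   : ∀ {P : Pred♯} {π : Projection} {Q qd h₁ h₂} {t : PT Q}
          → IsRPF g t → IsRPF g (scStep {P} π Q qd h₁ h₂ t)

  ReductionPairFunction : ProofTree → (ℕ → ℕ) → Set₁
  ReductionPairFunction T g = Monotone g × IsRPF g T

  DcBoundedBy : (ℕ → ℕ) → Set
  DcBoundedBy h = ∀ n (t : Term) → size t ≤ n → DhBound (Step (_∈ rules)) t (h n)

  DcMajorises : (ℕ → ℕ) → Set
  DcMajorises f = Σ ℕ λ M → ∀ n → M ≤ n →
                  Σ Term λ t → (size t ≤ n) × Σ ℕ λ k → (f n ≤ k) ×
                  Σ Term λ u → Chain (Step (_∈ rules)) k t u

{-# OPTIONS --safe #-}
module Submission where

-- Let T 0 f y = f^(y+1) 1 and T (j+1) f y = (T j)^y f y, so that T j suc is the Ackermann function A_{j+2}(1,0,…,0,·);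
-- every multiply recursive function is eventually below some T j suc.
--
-- Upper bound.  Call m a cost of t if k + |u| ≤ m whenever t →ᵏ u.  If every dependency pair leaving a set P of d
-- dependency pairs leads to a call whose cost is at most H of the total cost of its arguments, then a call entering P
-- costs at most T d (T d H) of that of its arguments.  This goes by induction on d and on the proof tree: a reduction
-- pair or subterm processor that removes pairs iterates the bound for d − 1 as often as the removed pairs can be used,
-- and T d is the diagonal of these iterates; a dependency graph processor only composes two such bounds, because a
-- split of P into parts without edges back lets every chain cross once.  For P = DP(R) there is nothing to leave, so H
-- can be a fixed Ackermann function above the reduction pair function.  Being a bound is stable under double negation,
-- which is why case distinctions on membership in the undecidable P are harmless.
--
-- Tightness.  The rules of an Ackermann function with nested doubling at level 0 fall to the subterm criterion alone,
-- one counter after the other.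

open import Defs
open import Data.Bool using (T?) renaming (T to True)
open import Data.Empty using (⊥; ⊥-elim)
open import Data.Fin using (Fin; zero; suc; toℕ; fromℕ; fromℕ<; inject₁)
open import Data.Fin.Induction using (<-weakInduction)
import Data.Fin.Properties as Fin
open import Data.List as List using (List; []; _∷_; _++_; [_]; replicate; length)
open import Data.List.Membership.Propositional using (_∈_)
open import Data.List.Membership.Propositional.Properties
  using (∈-map⁺; ∈-map⁻; ∈-concatMap⁺; ∈-++⁺ˡ; ∈-++⁺ʳ; ∈-allFin)
open import Data.List.Properties using (++-assoc; length-++; length-replicate)
open import Data.List.Relation.Unary.All as All using (All; []; _∷_)
import Data.List.Relation.Unary.All.Properties as All
open import Data.List.Relation.Unary.Any as Any using (here; there)
open import Data.List.Relation.Unary.Any.Properties using (any⁺; any⁻)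
open import Data.Nat
open import Data.Nat.GeneralisedArithmetic using (fold; fold-+)
open import Data.Nat.ListAction using (sum)
open import Data.Nat.Properties
open import Data.Product using (Σ; _×_; _,_; proj₁; proj₂)
open import Data.Sum as Sum using (_⊎_; inj₁; inj₂)
open import Data.Unit using (⊤; tt)
open import Data.Vec as Vec using (Vec; []; _∷_; lookup; toList; _[_]≔_)
open import Data.Vec.Properties
  using (length-toList; toList-∷ʳ; toList-replicate; lookup-replicate; lookup∘tabulate; tabulate∘lookup; tabulate-cong;
         lookup∘update; lookup∘update′; []≔-idempotent; []≔-lookup)
import Data.Vec.Relation.Unary.All as VAll
open import Data.Vec.Relation.Unary.All.Properties using (toList⁺; lookup⁺)
open import Function using (_∘_; id)
open import Relation.Binary.Construct.Closure.ReflexiveTransitive as Star using (Star; ε; _◅_; _◅◅_)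
open import Relation.Binary.PropositionalEquality
  using (_≡_; refl; sym; trans; cong; cong₂; subst; subst₂; module ≡-Reasoning)
open import Relation.Nullary using (¬_; Dec; yes; no; Stable)
open import Relation.Nullary.Decidable using (decidable-stable; fromWitness)

-- The Ackermann hierarchy

infix 9 _^[_]_
_^[_]_ : {A : Set} → (A → A) → ℕ → A → A
f ^[ n ] x = fold x f n

^-+ : ∀ {A : Set} (f : A → A) m n x → f ^[ m + n ] x ≡ f ^[ m ] (f ^[ n ] x)
^-+ f m n x = fold-+ x f m

^-suc : ∀ {A : Set} (f : A → A) n x → f ^[ suc n ] x ≡ f ^[ n ] (f x)
^-suc f n x = trans (cong (λ k → f ^[ k ] x) (+-comm 1 n)) (^-+ f n 1 x)

record Growing (f : ℕ → ℕ) : Set where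
  field
    mono : ∀ {x y} → x ≤ y → f x ≤ f y
    infl : ∀ x → x < f x
open Growing

suc-growing : Growing suc
suc-growing = record { mono = s≤s ; infl = λ x → ≤-refl }

^-mono : ∀ {f} → Growing f → ∀ n {x y} → x ≤ y → f ^[ n ] x ≤ f ^[ n ] y
^-mono gf zero    le = le
^-mono gf (suc n) le = mono gf (^-mono gf n le)

^-infl : ∀ {f} → Growing f → ∀ n x → n + x ≤ f ^[ n ] x
^-infl gf zero    x = ≤-refl
^-infl gf (suc n) x = ≤-trans (s≤s (^-infl gf n x)) (infl gf _)

^-monoˡ : ∀ {f} → Growing f → ∀ {m n} x → m ≤ n → f ^[ m ] x ≤ f ^[ n ] x
^-monoˡ {f} gf {m} {n} x le = begin
  f ^[ m ] x                 ≤⟨ m≤n+m _ (n ∸ m) ⟩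
  n ∸ m + f ^[ m ] x         ≤⟨ ^-infl gf (n ∸ m) _ ⟩
  f ^[ n ∸ m ] (f ^[ m ] x)  ≡⟨ ^-+ f (n ∸ m) m x ⟨
  f ^[ n ∸ m + m ] x         ≡⟨ cong (λ k → f ^[ k ] x) (m∸n+n≡m le) ⟩
  f ^[ n ] x                 ∎
  where open ≤-Reasoning

^-≤ : ∀ {f h} → Growing h → (∀ x → f x ≤ h x) → ∀ n x → f ^[ n ] x ≤ h ^[ n ] x
^-≤ gh le zero    x = ≤-refl
^-≤ gh le (suc n) x = ≤-trans (le _) (mono gh (^-≤ gh le n x))

-- The base operator `S` is a parameter because two hierarchies are compared: one over iteration,
-- matching the Ackermann functions, and one over doubling, matching the rewrite rules.
diagonal : ((ℕ → ℕ) → ℕ → ℕ) → ℕ → (ℕ → ℕ) → ℕ → ℕ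
diagonal S zero    f   = S f
diagonal S (suc j) f y = (diagonal S j ^[ y ] f) y

module Diagonal (S : (ℕ → ℕ) → ℕ → ℕ)
                (S-growing : ∀ {f} → Growing f → Growing (S f))
                (S-≥ : ∀ {f} → Growing f → ∀ x → f x ≤ S f x)
                where
  private
    F = diagonal S

  -- Simultaneous induction: monotonicity of the diagonal in `x` also raises the number of
  -- iterations, so `growing` at one level needs `iterate-mono` at the level below.
  mutual
    growing : ∀ j {f} → Growing f → Growing (F j f)
    growing zero gf = S-growing gf
    growing (suc j) {f} gf = record
      { mono = λ {x} {y} le → ≤-trans (mono (iterate-growing j x gf) le) (iterate-mono j gf le y)
      ; infl = λ x → infl (iterate-growing j x {f} gf) x }

    at-least : ∀ j {f} → Growing f → ∀ x → f x ≤ F j f x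
    at-least zero    gf x = S-≥ gf x
    at-least (suc j) gf x = iterate-mono j gf {0} {x} z≤n x

    iterate-growing : ∀ j n {f} → Growing f → Growing (F j ^[ n ] f)
    iterate-growing j zero    gf = gf
    iterate-growing j (suc n) gf = growing j (iterate-growing j n gf)

    iterate-mono : ∀ j {f} → Growing f → ∀ {m n} → m ≤ n → ∀ x → (F j ^[ m ] f) x ≤ (F j ^[ n ] f) x
    iterate-mono j gf {n = zero}  z≤n x = ≤-refl
    iterate-mono j gf {n = suc n} z≤n x =
      ≤-trans (iterate-mono j gf (z≤n {n}) x) (at-least j (iterate-growing j n gf) x)
    iterate-mono j {f} gf {suc m} {suc n} (s≤s le) x
      rewrite ^-suc (F j) m f | ^-suc (F j) n f = iterate-mono j (growing j gf) le x

private
  iterating doubling : (ℕ → ℕ) → ℕ → ℕ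
  iterating f y = f ^[ suc y ] 1
  doubling  f y = f (f y)

  iterating-growing : ∀ {f} → Growing f → Growing (iterating f)
  iterating-growing gf = record
    { mono = λ le → ^-monoˡ gf 1 (s≤s le)
    ; infl = λ x → ≤-trans (m≤m+n (suc x) 1) (^-infl gf (suc x) 1) }

  iterating-≥ : ∀ {f} → Growing f → ∀ x → f x ≤ iterating f x
  iterating-≥ gf x = mono gf (≤-trans (m≤m+n x 1) (^-infl gf x 1))

  doubling-growing : ∀ {f} → Growing f → Growing (doubling f)
  doubling-growing gf = record
    { mono = λ le → mono gf (mono gf le)
    ; infl = λ x → <-trans (infl gf x) (infl gf _) }

  doubling-≥ : ∀ {f} → Growing f → ∀ x → f x ≤ doubling f x
  doubling-≥ gf x = mono gf (<⇒≤ (infl gf x))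

-- A_{j+2}(x₁,…,x_{j+1},y) is T 0 ^[ x_{j+1} ] (… (T j ^[ x₁ ] suc)) applied to y.
T : ℕ → (ℕ → ℕ) → ℕ → ℕ
T = diagonal iterating

-- Doubling at level 0 needs a single rewrite rule, whereas T 0 takes two.
V : ℕ → (ℕ → ℕ) → ℕ → ℕ
V = diagonal doubling

open Diagonal iterating iterating-growing iterating-≥
  using () renaming (growing to T-growing; at-least to T-≥; iterate-growing to T^-growing; iterate-mono to T^-monoˡ)

open Diagonal doubling doubling-growing doubling-≥
  using () renaming (iterate-growing to V^-growing; iterate-mono to V^-monoˡ)

T-diag : ∀ j {f} → Growing f → ∀ {m x} → m ≤ x → (T j ^[ m ] f) x ≤ T (suc j) f x
T-diag j gf {x = x} le = T^-monoˡ j gf le x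

-- One extra level makes up for the weaker base: `V 0 ^[ x ] h` iterates `h` 2^x times, which is at
-- least the x + 1 iterations in `T 0`. Comparing two functions `f` and `h` is what lets the claim
-- pass through the iterates at higher levels.
T≤V : ∀ i {f h} → Growing f → Growing h → (∀ {x} → 1 ≤ x → f x ≤ h x) → ∀ {x} → 1 ≤ x → T i f x ≤ V (suc i) h x
T≤V zero {f} {h} gf gh f≤h {x} 1≤x = ≤-trans (iterates (suc x)) (^≤V^ x x)
  where
  iterates : ∀ n → f ^[ n ] 1 ≤ h ^[ n ] x
  iterates zero    = 1≤x
  iterates (suc n) = ≤-trans (mono gf (iterates n)) (f≤h (≤-trans 1≤x (≤-trans (m≤n+m x n) (^-infl gh n x))))
  ^≤V^ : ∀ n x → h ^[ suc n ] x ≤ (V 0 ^[ n ] h) x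
  ^≤V^ zero    x = ≤-refl
  ^≤V^ (suc n) x = begin
    h ^[ suc (suc n) ] x           ≡⟨ ^-suc h (suc n) x ⟩
    h ^[ suc n ] (h x)             ≤⟨ ^≤V^ n (h x) ⟩
    (V 0 ^[ n ] h) (h x)           ≤⟨ mono (V^-growing 0 n gh) (V^-monoˡ 0 gh (z≤n {n}) x) ⟩
    (V 0 ^[ suc n ] h) x           ∎
    where open ≤-Reasoning
T≤V (suc i) {f} {h} gf gh f≤h {x} 1≤x = iterates x 1≤x
  where
  iterates : ∀ n {y} → 1 ≤ y → (T i ^[ n ] f) y ≤ (V (suc i) ^[ n ] h) y
  iterates zero    = f≤h
  iterates (suc n) = T≤V i (T^-growing i n gf) (V^-growing (suc i) n gh) (iterates n)

-- At level 0, f^(x+1)(x) is at most f^(2x+1)(1), which is `T 0 f` at 2x, and iterating `T 0 f` from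
-- 1 reaches 2x in x steps. Higher levels contain two applications of the level below as soon as x
-- is at least 2.
T-twice : ∀ j {f} → Growing f → ∀ {x} → 2 ≤ x → f ^[ suc x ] x ≤ T j (T j f) x
T-twice zero {f} gf {x} _ = begin
  f ^[ suc x ] x              ≤⟨ ^-mono gf (suc x) (≤-trans (m≤m+n x 1) (^-infl gf x 1)) ⟩
  f ^[ suc x ] (f ^[ x ] 1)   ≡⟨ ^-+ f (suc x) x 1 ⟨
  T 0 f (x + x)               ≤⟨ mono (T-growing 0 gf) (double x) ⟩
  T 0 (T 0 f) x               ∎
  where
  open ≤-Reasoning
  double : ∀ y → y + y ≤ T 0 f ^[ y ] 1
  double zero    = z≤n
  double (suc y) = begin
    suc y + suc y             ≡⟨ cong suc (+-suc y y) ⟩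
    2 + (y + y)               ≤⟨ +-monoʳ-≤ 2 (double y) ⟩
    2 + T 0 f ^[ y ] 1        ≡⟨ +-comm 2 _ ⟩
    T 0 f ^[ y ] 1 + 2        ≡⟨ +-suc _ 1 ⟩
    suc (T 0 f ^[ y ] 1) + 1  ≤⟨ ^-infl gf _ 1 ⟩
    T 0 f ^[ suc y ] 1        ∎
T-twice (suc j) {f} gf {x} 2≤x = begin
  f ^[ suc x ] x              ≤⟨ ^-≤ gTf (T-≥ (suc j) gf) (suc x) x ⟩
  T (suc j) f ^[ suc x ] x    ≤⟨ T-twice j gTf 2≤x ⟩
  T j (T j (T (suc j) f)) x   ≤⟨ T-diag j gTf 2≤x ⟩
  T (suc j) (T (suc j) f) x   ∎
  where
  open ≤-Reasoning
  gTf = T-growing (suc j) gf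

-- Above level 0 a single further application is enough, since the diagonal already contains the two
-- applications of `T j`.
T-twice-suc : ∀ j {f} → Growing f → ∀ {x} → 2 ≤ x →
              T (suc j) f ^[ suc x ] x ≤ T (suc j) (T (suc j) f) x
T-twice-suc j gf 2≤x = ≤-trans (T-twice j gTf 2≤x) (T-diag j gTf 2≤x)
  where gTf = T-growing (suc j) gf

B : ℕ → ℕ → ℕ
B j = T j suc

B-growing : ∀ j → Growing (B j)
B-growing j = T-growing j suc-growing

B-mono : ∀ {i j x} → i ≤ j → 1 ≤ x → B i x ≤ B j x
B-mono {i} {j} {x} le 1≤x = go (≤⇒≤′ le)
  where
  go : ∀ {j} → i ≤′ j → B i x ≤ B j x
  go ≤′-refl       = ≤-refl
  go (≤′-step {j} le′) = ≤-trans (go le′) (T-diag j suc-growing 1≤x)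

-- The 3 counts applications of `T j`: one inside `B j` and two from `T-twice`.
B-iterate : ∀ j {x} → 3 ≤ x → B j ^[ suc x ] x ≤ B (suc j) x
B-iterate j 3≤x = ≤-trans (T-twice j (B-growing j) (≤-trans (n≤1+n 2) 3≤x))
                          (T-diag j suc-growing 3≤x)

B-double : ∀ i {x} → 2 ≤ x → x + x ≤ B (suc i) x
B-double i {x} 2≤x = begin
  x + x             ≤⟨ n≤1+n _ ⟩
  suc x + x         ≤⟨ ^-infl suc-growing (suc x) x ⟩
  suc ^[ suc x ] x  ≤⟨ T-twice i suc-growing 2≤x ⟩
  T i (T i suc) x   ≤⟨ T-diag i suc-growing 2≤x ⟩
  B (suc i) x       ∎
  where open ≤-Reasoning

-- Evaluating the graph of the Ackermann functions

private
  -- what f has become after the arguments xs, when m + 1 more arguments follow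
  prefix : (ℕ → ℕ) → List ℕ → ℕ → ℕ → ℕ
  prefix f []       m = f
  prefix f (x ∷ xs) m = prefix (T (length xs + m) ^[ x ] f) xs m

  -- `ev suc` is a closed form of the Ackermann functions; the accumulated function `f` absorbs the
  -- leading arguments one by one.
  ev : (ℕ → ℕ) → List ℕ → ℕ
  ev f []           = f 0
  ev f (y ∷ [])     = f y
  ev f (x ∷ y ∷ xs) = ev (T (length xs) ^[ x ] f) (y ∷ xs)

  ev-++ : ∀ f xs y ys → ev f (xs ++ y ∷ ys) ≡ ev (prefix f xs (length ys)) (y ∷ ys)
  ev-++ f []            y ys = refl
  ev-++ f (x ∷ [])      y ys = refl
  ev-++ f (x ∷ x' ∷ xs) y ys rewrite ev-++ (T (length (xs ++ y ∷ ys)) ^[ x ] f) (x' ∷ xs) y ys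
    | length-++ xs {y ∷ ys} | +-suc (length xs) (length ys) = refl

  ev-zeros : ∀ f n x → ev f (replicate n 0 ++ [ x ]) ≡ f x
  ev-zeros f zero          x = refl
  ev-zeros f (suc zero)    x = refl
  ev-zeros f (suc (suc n)) x = ev-zeros f (suc n) x

  length-zeros : ∀ n (x : ℕ) → length (replicate n 0 ++ [ x ]) ≡ suc n
  length-zeros n x = trans (length-++ (replicate n 0)) (trans (+-comm _ 1) (cong suc (length-replicate n)))

  ev-cons : ∀ f x ys y → ev f (x ∷ ys ++ [ y ]) ≡ ev (T (length ys) ^[ x ] f) (ys ++ [ y ])
  ev-cons f x []        y = refl
  ev-cons f x (z ∷ ys) y rewrite length-++ ys {[ y ]} | +-comm (length ys) 1 = refl

  -- Once `ev-++` has evaluated the common prefix, each clause of the graph is an equation of `T`: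
  -- `a2` and `a3` unfold the iteration in `T 0`, and `a4` is the diagonal in `T (suc j)`.
  AckR-ev : ∀ {xs r} → AckR xs r → r ≡ ev suc xs
  AckR-ev (a1 n x) = sym (ev-zeros suc (suc n) x)
  AckR-ev (a2 xs x r p) = trans (AckR-ev p)
    (trans (ev-++ suc xs x (1 ∷ [])) (sym (ev-++ suc xs (suc x) (0 ∷ []))))
  AckR-ev (a3 xs x y r s p q) with refl ← AckR-ev p = trans (AckR-ev q)
    (trans (ev-++ suc xs x _)
      (trans (cong (T 0 ^[ x ] prefix suc xs 1) (ev-++ suc xs (suc x) (y ∷ [])))
             (sym (ev-++ suc xs (suc x) (suc y ∷ [])))))
  AckR-ev (a4 xs x j y r p) = trans (AckR-ev p) (trans lhs-eq (sym rhs-eq))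
    where
    open ≡-Reasoning
    zs = replicate j 0 ++ [ y ]
    h = prefix suc xs (suc (suc j))
    lhs-eq : ev suc (xs ++ x ∷ y ∷ (replicate j 0 ++ [ y ])) ≡ (T j ^[ y ] (T (suc j) ^[ x ] h)) y
    lhs-eq = begin
      ev suc (xs ++ x ∷ y ∷ zs)
        ≡⟨ ev-++ suc xs x (y ∷ zs) ⟩
      ev (prefix suc xs (suc (length zs))) (x ∷ y ∷ zs)
        ≡⟨ cong (λ l → ev (prefix suc xs (suc l)) (x ∷ y ∷ zs)) (length-zeros j y) ⟩
      ev h (x ∷ y ∷ zs)
        ≡⟨ ev-cons h x (y ∷ replicate j 0) y ⟩
      ev (T (suc (length (replicate j 0))) ^[ x ] h) (y ∷ zs)
        ≡⟨ ev-cons _ y (replicate j 0) y ⟩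
      ev (T (length (replicate j 0)) ^[ y ] (T (suc (length (replicate j 0))) ^[ x ] h)) zs
        ≡⟨ ev-zeros _ j y ⟩
      (T (length (replicate j 0)) ^[ y ] (T (suc (length (replicate j 0))) ^[ x ] h)) y
        ≡⟨ cong (λ l → (T l ^[ y ] (T (suc l) ^[ x ] h)) y) (length-replicate j) ⟩
      (T j ^[ y ] (T (suc j) ^[ x ] h)) y ∎
    rhs-eq : ev suc (xs ++ suc x ∷ (replicate (suc j) 0 ++ [ y ])) ≡ (T j ^[ y ] (T (suc j) ^[ x ] h)) y
    rhs-eq = begin
      ev suc (xs ++ suc x ∷ 0 ∷ zs)
        ≡⟨ ev-++ suc xs (suc x) (0 ∷ zs) ⟩
      ev (prefix suc xs (suc (length zs))) (suc x ∷ 0 ∷ zs)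
        ≡⟨ cong (λ l → ev (prefix suc xs (suc l)) (suc x ∷ 0 ∷ zs)) (length-zeros j y) ⟩
      ev h (suc x ∷ 0 ∷ zs)
        ≡⟨ ev-cons h (suc x) (replicate (suc j) 0) y ⟩
      ev (T (suc (length (replicate j 0))) ^[ suc x ] h) (0 ∷ zs)
        ≡⟨ ev-zeros _ (suc j) y ⟩
      (T (suc (length (replicate j 0))) ^[ suc x ] h) y
        ≡⟨ cong (λ l → (T (suc l) ^[ suc x ] h) y) (length-replicate j) ⟩
      (T j ^[ y ] (T (suc j) ^[ x ] h)) y ∎

  -- Strictness pays for the induction: x applications of `T` together with the one from the
  -- remaining arguments make x + 1, at most `M`, which the diagonal absorbs.
  ev-bound : ∀ {f M} y xs → Growing f → All (_< M) (y ∷ xs) → ev f (y ∷ xs) ≤ T (length xs) f M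
  ev-bound y []       gf (lt ∷ _)  = ≤-trans (mono gf (<⇒≤ lt)) (T-≥ 0 gf _)
  ev-bound x (y ∷ xs) gf (lt ∷ lts) =
    ≤-trans (ev-bound y xs (T^-growing (length xs) x gf) lts) (T-diag (length xs) gf lt)

  -- The prefix `xs` is arbitrary because clause `a4` copies `y` into the next argument, which is
  -- then counted up from zero while `x` has become part of the prefix.
  AckR-suc : ∀ xs x j f → (∀ y → AckR (xs ++ x ∷ replicate j 0 ++ [ y ]) (f y))
           → ∀ y → AckR (xs ++ suc x ∷ replicate j 0 ++ [ y ]) (T j f y)
  AckR-suc xs x zero    f p zero    = a2 xs x (f 1) (p 1)
  AckR-suc xs x zero    f p (suc y) = a3 xs x y _ _ (AckR-suc xs x 0 f p y) (p (T 0 f y))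
  AckR-suc xs x (suc j) f p y       = a4 xs x j y _ (iterated y y)
    where
    iterated : ∀ z y → AckR (xs ++ x ∷ z ∷ replicate j 0 ++ [ y ]) ((T j ^[ z ] f) y)
    iterated zero    = p
    iterated (suc z) y = subst (λ l → AckR l ((T j ^[ suc z ] f) y)) (++-assoc xs [ x ] _)
      (AckR-suc (xs ++ [ x ]) z j (T j ^[ z ] f)
        (λ y → subst (λ l → AckR l ((T j ^[ z ] f) y)) (sym (++-assoc xs [ x ] _)) (iterated z y)) y)

B-AckR : ∀ j y → AckR (1 ∷ replicate j 0 ++ [ y ]) (B j y)
B-AckR j = AckR-suc [] 0 j suc (a1 j)

-- The final complexity bound has this form; the shift by `c` turns an estimate valid only for large
-- arguments into one for all `n`.
B-shift-multRec : ∀ j c → MultRec (λ n → B j (c + n))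
B-shift-multRec j c = compF (ackF j) (oneF ∷ (Vec.replicate j (zeroF 1) Vec.∷ʳ plus c)) , λ n →
  ecomp (ecomp (ezero ∷ []) esucc ∷ evals j n)
        (eack (subst (λ l → AckR (1 ∷ l) (B j (c + n))) (sym (value j n)) (B-AckR j (c + n))))
  where
  oneF : MRC 1
  oneF = compF succF (zeroF 1 ∷ [])
  plus : ℕ → MRC 1
  plus zero    = projF zero
  plus (suc c) = compF succF (plus c ∷ [])
  eval-plus : ∀ c n → Eval (plus c) (n ∷ []) (c + n)
  eval-plus zero    n = eproj zero
  eval-plus (suc c) n = ecomp (eval-plus c n ∷ []) esucc
  evals : ∀ j n → EvalAll (Vec.replicate j (zeroF 1) Vec.∷ʳ plus c) (n ∷ []) (Vec.replicate j 0 Vec.∷ʳ (c + n))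
  evals zero    n = eval-plus c n ∷ []
  evals (suc j) n = ezero ∷ evals j n
  value : ∀ j n → toList (Vec.replicate j 0 Vec.∷ʳ (c + n)) ≡ replicate j 0 ++ [ c + n ]
  value j n = trans (toList-∷ʳ (c + n) (Vec.replicate j 0)) (cong (_++ [ c + n ]) (toList-replicate j 0))

-- Majorising multiply recursive functions

private
  -- The level `j` doubles as the threshold for `x`; the constant 3 is the one of `B-iterate`.
  Majorised : ∀ {k} → MRC k → ℕ → Set
  Majorised c j = ∀ {x xs r} → 3 ≤ x → j ≤ x → VAll.All (_≤ x) xs → Eval c xs r → r ≤ B j x

  ackF-majorised : ∀ k → Majorised (ackF k) (2 + k)
  ackF-majorised k {x} {y ∷ ys} {r} 3≤x _ les (eack p) = begin
    r                               ≡⟨ AckR-ev p ⟩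
    ev suc (toList (y ∷ ys))        ≤⟨ ev-bound y (toList ys) suc-growing (toList⁺ (VAll.map s≤s les)) ⟩
    B (length (toList ys)) (suc x)  ≡⟨ cong (λ l → B l (suc x)) (length-toList ys) ⟩
    B (suc k) (suc x)               ≤⟨ mono (B-growing (suc k)) (infl (B-growing (suc k)) x) ⟩
    B (suc k) ^[ 2 ] x              ≤⟨ ^-monoˡ (B-growing (suc k)) x (≤-trans (n≤1+n 2) (m≤n⇒m≤1+n 3≤x)) ⟩
    B (suc k) ^[ suc x ] x          ≤⟨ B-iterate (suc k) 3≤x ⟩
    B (2 + k) x                     ∎
    where open ≤-Reasoning

  mutual
    majorise : ∀ {k} (c : MRC k) → Σ ℕ (Majorised c)
    majorise (zeroF k) = 0 , λ { _ _ _ ezero → z≤n }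
    majorise succF = 0 , λ { {x} _ _ (le VAll.∷ _) esucc → ≤-trans (s≤s le) (infl (B-growing 0) x) }
    majorise (projF i) = 0 , λ { {x} _ _ les (eproj .i) → ≤-trans (lookup⁺ les i) (<⇒≤ (infl (B-growing 0) x)) }
    majorise (ackF k) = 2 + k , ackF-majorised k
    majorise (compF h gs) with majorise h | majoriseAll gs
    ... | i , Mh | j , Mgs = suc (i ⊔ j) , bound
      where
      open ≤-Reasoning
      bound : Majorised (compF h gs) (suc (i ⊔ j))
      bound {x} {xs} {r} 3≤x le les (ecomp {ys = ys} es e) = begin
        r                      ≤⟨ Mh (≤-trans 3≤x x≤) (≤-trans i≤ x≤)
                                   (VAll.map (λ p → ≤-trans p (B-mono (m≤n⊔m i j) 1≤x)) (Mgs 3≤x j≤ les es)) e ⟩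
        B i (B (i ⊔ j) x)      ≤⟨ B-mono (m≤m⊔n i j) (≤-trans 1≤x x≤) ⟩
        B (i ⊔ j) ^[ 2 ] x     ≤⟨ ^-monoˡ (B-growing (i ⊔ j)) x (≤-trans (n≤1+n 2) (m≤n⇒m≤1+n 3≤x)) ⟩
        B (i ⊔ j) ^[ suc x ] x ≤⟨ B-iterate (i ⊔ j) 3≤x ⟩
        B (suc (i ⊔ j)) x      ∎
        where
        1≤x = ≤-trans (s≤s z≤n) 3≤x
        i≤ = ≤-trans (m≤m⊔n i j) (<⇒≤ le)
        j≤ = ≤-trans (m≤n⊔m i j) (<⇒≤ le)
        x≤ = <⇒≤ (infl (B-growing (i ⊔ j)) x)
    majorise (precF g h) with majorise g | majorise h
    ... | i , Mg | j , Mh = suc (i ⊔ j) , bound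
      where
      b = B (i ⊔ j)
      gb = B-growing (i ⊔ j)
      -- By the y-th stage the counter, the parameters and the recursive value all lie below
      -- `b ^[ suc y ] x`, so this number can serve as the new maximum when the bound for `h` is
      -- applied.
      rec : ∀ {x y xs r} → 3 ≤ x → i ⊔ j ≤ x → y ≤ x → VAll.All (_≤ x) xs
          → Eval (precF g h) (y ∷ xs) r → r ≤ b ^[ suc y ] x
      rec 3≤x le _ les (eprec0 e) =
        ≤-trans (Mg 3≤x (≤-trans (m≤m⊔n i j) le) les e) (B-mono (m≤m⊔n i j) (≤-trans (s≤s z≤n) 3≤x))
      rec {x} {suc y} 3≤x le y≤x les (eprecS e e′) =
        ≤-trans (Mh (≤-trans 3≤x x≤) (≤-trans (≤-trans (m≤n⊔m i j) le) x≤)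
                   (≤-trans (≤-trans (n≤1+n y) y≤x) x≤ VAll.∷ rec 3≤x le (≤-trans (n≤1+n y) y≤x) les e
                     VAll.∷ VAll.map (λ p → ≤-trans p x≤) les) e′)
                (B-mono (m≤n⊔m i j) (≤-trans (≤-trans (s≤s z≤n) 3≤x) x≤))
        where x≤ = ≤-trans (m≤n+m x (suc y)) (^-infl gb (suc y) x)
      bound : Majorised (precF g h) (suc (i ⊔ j))
      bound {x} {y ∷ _} 3≤x le (y≤x VAll.∷ les) e =
        ≤-trans (rec 3≤x (<⇒≤ le) y≤x les e)
                (≤-trans (^-monoˡ gb x (s≤s y≤x)) (B-iterate (i ⊔ j) 3≤x))

    majoriseAll : ∀ {k m} (gs : Vec (MRC k) m) → Σ ℕ λ j → ∀ {x xs ys} → 3 ≤ x → j ≤ x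
                → VAll.All (_≤ x) xs → EvalAll gs xs ys → VAll.All (_≤ B j x) ys
    majoriseAll [] = 0 , λ { _ _ _ [] → VAll.[] }
    majoriseAll (g ∷ gs) with majorise g | majoriseAll gs
    ... | i , Mg | j , Mgs = i ⊔ j , λ { {x} 3≤x le les (e ∷ es) →
      let 1≤x = ≤-trans (s≤s z≤n) 3≤x in
      ≤-trans (Mg 3≤x (≤-trans (m≤m⊔n i j) le) les e) (B-mono (m≤m⊔n i j) 1≤x)
      VAll.∷ VAll.map (λ p → ≤-trans p (B-mono (m≤n⊔m i j) 1≤x)) (Mgs 3≤x (≤-trans (m≤n⊔m i j) le) les es) }

multRec-majorised : ∀ {f} → MultRec f → Σ ℕ λ j → ∀ x → j ≤ x → f x ≤ B j x
multRec-majorised (c , e) with majorise c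
... | j , M = j ⊔ 3 , λ x le →
  let 3≤x = ≤-trans (m≤n⊔m j 3) le in
  ≤-trans (M 3≤x (≤-trans (m≤m⊔n j 3) le) (≤-refl VAll.∷ VAll.[]) (e x)) (B-mono (m≤m⊔n j 3) (≤-trans (s≤s z≤n) 3≤x))

-- Bounding derivations along a proof tree

by-cases : ∀ {a b} {X : Set a} (Y : Set b) → Stable X → (Y → X) → (¬ Y → X) → X
by-cases Y st f h = st λ ¬x → ¬x (h (λ y → ¬x (f y)))

remove : ∀ {A : Set} {a : A} {l} → a ∈ l
       → Σ (List A) λ l′ → length l ≡ suc (length l′) × (∀ {x} → x ∈ l → x ≡ a ⊎ x ∈ l′)
remove {l = _ ∷ l} (here refl) = l , refl , λ { (here eq) → inj₁ eq ; (there i) → inj₂ i }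
remove {l = x ∷ _} (there i) with l′ , eq , rest ← remove i =
  x ∷ l′ , cong suc eq , λ { (here eq′) → inj₂ (here eq′)
                           ; (there i′) → Sum.map id there (rest i′) }

-- Double negation commutes with quantification over a finite list; this is where finiteness of the
-- set of dependency pairs replaces decidability.
¬¬-shift : ∀ {A : Set} {Y : A → Set} l → (∀ a → ¬ ¬ Y a) → ¬ ¬ (∀ {a} → a ∈ l → Y a)
¬¬-shift []      nn k = k λ ()
¬¬-shift (a ∷ l) nn k = nn a λ y → ¬¬-shift l nn λ ys → k λ { (here refl) → y ; (there i) → ys i }

module UpperBound (S : TRS) where
  open DPF S

  infix 4 _⟶R_
  _⟶R_ : Term → Term → Set
  _⟶R_ = Step (_∈ rules)

  -- Adding the size makes the bound drop strictly under proper subterms as well as under reduction.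
  D : ℕ → Term → Set
  D m t = ∀ k u → Chain _⟶R_ k t u → k + size u ≤ m

  D-stable : ∀ {m t} → Stable (D m t)
  D-stable {m} nn k u c = decidable-stable (k + size u ≤? m) (λ ¬le → nn (λ d → ¬le (d k u c)))

  D-mono : ∀ {m n t} → m ≤ n → D m t → D n t
  D-mono le d k u c = ≤-trans (d k u c) le

  size-lookup : ∀ {n} (ts : Vec Term n) i → size (lookup ts i) ≤ sizes ts
  size-lookup (t ∷ ts) zero    = m≤m+n _ _
  size-lookup (t ∷ ts) (suc i) = ≤-trans (size-lookup ts i) (m≤n+m _ _)

  1≤size : ∀ t → 1 ≤ size t
  1≤size (var x)    = ≤-refl
  1≤size (fun f ts) = s≤s z≤n

  D-pos : ∀ {m t} → D m t → Σ ℕ λ m′ → m ≡ suc m′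
  D-pos {suc m} d = m , refl
  D-pos {zero} {t} d with () ← ≤-trans (1≤size t) (d 0 t done)

  D-step : ∀ {m t t′} → D (suc m) t → t ⟶R t′ → D m t′
  D-step d s k u c = s≤s⁻¹ (d (suc k) u (step s c))

  chain-arg : ∀ {f} (ts : Vec Term (ar f)) i {k t u} → Chain _⟶R_ k t u
            → Chain _⟶R_ k (fun f (ts [ i ]≔ t)) (fun f (ts [ i ]≔ u))
  chain-arg ts i done = done
  chain-arg {f} ts i {t = t} (step {b = t′} s c) = step
    (subst (λ ts′ → fun f (ts [ i ]≔ t) ⟶R fun f ts′) ([]≔-idempotent ts i)
      (argStep i (subst (_⟶R t′) (sym (lookup∘update i ts t)) s)))
    (chain-arg ts i c)

  -- A chain from the argument lifts to the whole term, whose root symbol adds one to the size.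
  D-arg : ∀ {m f ts} i → D (suc m) (fun f ts) → D m (lookup ts i)
  D-arg {m} {f} {ts} i d k u c = s≤s⁻¹ (begin
    suc (k + size u)                          ≡⟨ cong (λ t → suc (k + size t)) (lookup∘update i ts u) ⟨
    suc (k + size (lookup (ts [ i ]≔ u) i))   ≤⟨ s≤s (+-monoʳ-≤ k (size-lookup (ts [ i ]≔ u) i)) ⟩
    suc (k + sizes (ts [ i ]≔ u))             ≡⟨ +-suc k _ ⟨
    k + size (fun f (ts [ i ]≔ u))            ≤⟨ d k (fun f (ts [ i ]≔ u)) lifted ⟩
    suc m                                     ∎)
    where
    open ≤-Reasoning
    lifted : Chain _⟶R_ k (fun f ts) (fun f (ts [ i ]≔ u))
    lifted = subst (λ ts′ → Chain _⟶R_ k (fun f ts′) (fun f (ts [ i ]≔ u)))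
      ([]≔-lookup ts i) (chain-arg ts i c)

  D-⊵ : ∀ {m t u} → t ⊵ u → D m t → D m u
  D-⊵ ⊵-refl d = d
  D-⊵ (⊵-arg i p) d with m , refl ← D-pos d = D-⊵ p (D-mono (n≤1+n m) (D-arg i d))

  D-▷ : ∀ {m t u} → t ▷ u → D (suc m) t → D m u
  D-▷ (▷-arg i p) d = D-⊵ p (D-arg i d)

  -- DV m ts: bounds for the entries of ts with sum at most m.
  data DV : ∀ {n} → ℕ → Vec Term n → Set where
    []  : ∀ {m} → DV m []
    _∷_ : ∀ {n m k t} {ts : Vec Term n} → D m t → DV k ts → DV (m + k) (t ∷ ts)

  DV-lookup : ∀ {n m} {ts : Vec Term n} → DV m ts → ∀ i → D m (lookup ts i)
  DV-lookup (d ∷ ds) zero    = D-mono (m≤m+n _ _) d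
  DV-lookup (_∷_ {m = m} d ds) (suc i) = D-mono (m≤n+m _ m) (DV-lookup ds i)

  DV-sizes : ∀ {n m} {ts : Vec Term n} → DV m ts → sizes ts ≤ m
  DV-sizes []       = z≤n
  DV-sizes (d ∷ ds) = +-mono-≤ (d 0 _ done) (DV-sizes ds)

  DV-step : ∀ {n m} {ts : Vec Term n} {t} i → DV m ts → lookup ts i ⟶R t
          → Σ ℕ λ m′ → m ≡ suc m′ × DV m′ (ts [ i ]≔ t)
  DV-step zero (d ∷ ds) s with _ , refl ← D-pos d = _ , refl , D-step d s ∷ ds
  DV-step (suc i) (_∷_ {m = m} d ds) s with k , refl , ds′ ← DV-step i ds s = m + k , +-suc m k , d ∷ ds′

  DV-suc : ∀ {n m} {ts : Vec Term n} → DV m ts → DV (suc m) ts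
  DV-suc []       = []
  DV-suc (_∷_ d ds) = D-mono (n≤1+n _) d ∷ ds

  -- Moves between calls

  data ArgMove : Term → Term → Set where
    arg : ∀ {f ts t} i → lookup ts i ⟶R t → ArgMove (fun f ts) (fun f (ts [ i ]≔ t))

  -- Calls act on plain terms, where `D` makes sense; the sharped pair appears only as evidence of
  -- membership in `P`.
  data DPMove (P : Pred♯) : Term → Term → Set where
    call : ∀ {f ls g us} → P (sharp (fun f ls) ♯.⟶ sharp (fun g us)) → ∀ σ
         → DPMove P (fun f (subs σ ls)) (fun g (subs σ us))

  Move : Pred♯ → Term → Term → Set
  Move P s t = ArgMove s t ⊎ DPMove P s t

  DPMove-map : ∀ {P Q} → P ⊆ Q → ∀ {s t} → DPMove P s t → DPMove Q s t
  DPMove-map sub′ (call p σ) = call (sub′ _ p) σ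

  Move-map : ∀ {P Q} → P ⊆ Q → ∀ {s t} → Move P s t → Move Q s t
  Move-map sub′ (inj₁ a) = inj₁ a
  Move-map sub′ (inj₂ c) = inj₂ (DPMove-map sub′ c)

  ArgsD : ℕ → Term → Set
  ArgsD m (var x)    = ⊤
  ArgsD m (fun f ts) = DV m ts

  ArgsD-moves : ∀ {m s t} → Star ArgMove s t → ArgsD m s → ArgsD m t
  ArgsD-moves ε ds = ds
  ArgsD-moves (arg i s ◅ st) ds with _ , refl , ds′ ← DV-step i ds s = ArgsD-moves st (DV-suc ds′)

  -- Before the first root step every step lowers the total cost `m` of the arguments; the root step
  -- costs one and leaves a term of cost at most `n`.
  D-fun : ∀ {f ts m n} → DV m ts
        → (∀ {ρ} → ρ ∈ rules → ∀ σ → Star ArgMove (fun f ts) (sub σ (lhs ρ)) → D n (sub σ (rhs ρ)))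
        → D (suc (m + n)) (fun f ts)
  D-fun ds h k u c = go ds h c refl
    where
    go : ∀ {f ts m n t k u} → DV m ts
       → (∀ {ρ} → ρ ∈ rules → ∀ σ → Star ArgMove (fun f ts) (sub σ (lhs ρ)) → D n (sub σ (rhs ρ)))
       → Chain _⟶R_ k t u → t ≡ fun f ts → k + size u ≤ suc (m + n)
    go {m = m} {n} ds h done refl = s≤s (≤-trans (DV-sizes ds) (m≤m+n m n))
    go {m = m} {n} ds h (step (rootStep r σ) c) eq =
      s≤s (≤-trans (h r σ (subst (Star ArgMove _) (sym eq) ε) _ _ c) (m≤n+m n m))
    go ds h (step (argStep i s) c) refl with _ , refl , ds′ ← DV-step i ds s =
      s≤s (go ds′ (λ r σ st → h r σ (arg i s ◅ st)) c refl)

  lookup-subs : ∀ {n} σ (ts : Vec Term n) i → lookup (subs σ ts) i ≡ sub σ (lookup ts i)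
  lookup-subs σ (t ∷ ts) zero    = refl
  lookup-subs σ (t ∷ ts) (suc i) = lookup-subs σ ts i

  ⊵-trans : ∀ {s t u} → s ⊵ t → t ⊵ u → s ⊵ u
  ⊵-trans ⊵-refl      q = q
  ⊵-trans (⊵-arg i p) q = ⊵-arg i (⊵-trans p q)

  sub-⊵ : ∀ {t u} σ → t ⊵ u → sub σ t ⊵ sub σ u
  sub-⊵ σ ⊵-refl = ⊵-refl
  sub-⊵ σ (⊵-arg {ts = ts} i p) = ⊵-arg i (subst (_⊵ _) (sym (lookup-subs σ ts i)) (sub-⊵ σ p))

  sub-▷ : ∀ {t u} σ → t ▷ u → sub σ t ▷ sub σ u
  sub-▷ σ (▷-arg {ts = ts} i p) = ▷-arg i (subst (_⊵ _) (sym (lookup-subs σ ts i)) (sub-⊵ σ p))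

  mutual
    sub-var : ∀ t → sub var t ≡ t
    sub-var (var x)    = refl
    sub-var (fun f ts) = cong (fun f) (subs-var ts)

    subs-var : ∀ {n} (ts : Vec Term n) → subs var ts ≡ ts
    subs-var []       = refl
    subs-var (t ∷ ts) = cong₂ _∷_ (sub-var t) (subs-var ts)

  -- The bound on sub σ u obtained bottom-up when H bounds every call whose arguments are bounded.
  mutual
    bnd : (ℕ → ℕ) → ℕ → Term → ℕ
    bnd H m (var x)    = m
    bnd H m (fun f ts) = H (bnds H m ts)

    bnds : ∀ {n} → (ℕ → ℕ) → ℕ → Vec Term n → ℕ
    bnds H m []       = m
    bnds H m (t ∷ ts) = bnd H m t + bnds H m ts

  -- The weight counts applications of `H`: one per function symbol, and one per argument to absorb
  -- the addition in `bnds` by doubling.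
  mutual
    weight : Term → ℕ
    weight (var x)    = 0
    weight (fun f ts) = suc (weights ts)

    weights : ∀ {n} → Vec Term n → ℕ
    weights []       = 0
    weights (t ∷ ts) = suc (weight t + weights ts)

  mutual
    weight-size : ∀ t → suc (weight t) ≤ size t + size t
    weight-size (var x)    = s≤s z≤n
    weight-size (fun f ts) = s≤s (≤-trans (s≤s (weights-size ts)) (≤-reflexive (sym (+-suc _ _))))

    weights-size : ∀ {n} (ts : Vec Term n) → weights ts ≤ sizes ts + sizes ts
    weights-size []       = z≤n
    weights-size (t ∷ ts) = ≤-trans (+-mono-≤ (weight-size t) (weights-size ts))
      (≤-reflexive (interchange (size t) (sizes ts)))
      where
      interchange : ∀ a b → (a + a) + (b + b) ≡ (a + b) + (a + b)
      interchange a b = trans (+-assoc a a _) (trans (cong (a +_) (trans (sym (+-assoc a b b))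
        (trans (cong (_+ b) (+-comm a b)) (+-assoc b a b)))) (sym (+-assoc a b _)))

  bnds-≥ : ∀ {n} H m (ts : Vec Term n) → m ≤ bnds H m ts
  bnds-≥ H m []       = ≤-refl
  bnds-≥ H m (t ∷ ts) = ≤-trans (bnds-≥ H m ts) (m≤n+m _ _)

  module _ {H : ℕ → ℕ} (gH : Growing H) {m : ℕ} (double : ∀ {x} → m ≤ x → x + x ≤ H x) where
    mutual
      bnd-≤ : ∀ t → bnd H m t ≤ H ^[ weight t ] m
      bnd-≤ (var x)    = ≤-refl
      bnd-≤ (fun f ts) = mono gH (bnds-≤ ts)

      bnds-≤ : ∀ {n} (ts : Vec Term n) → bnds H m ts ≤ H ^[ weights ts ] m
      bnds-≤ []       = ≤-refl
      bnds-≤ (t ∷ ts) = ≤-trans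
        (+-mono-≤ (≤-trans (bnd-≤ t) (^-monoˡ gH m (m≤m+n (weight t) (weights ts))))
                  (≤-trans (bnds-≤ ts) (^-monoˡ gH m (m≤n+m (weights ts) (weight t)))))
        (double (≤-trans (m≤n+m m _) (^-infl gH (weight t + weights ts) m)))

  module _ {H : ℕ → ℕ} {m : ℕ} {σ : Subst} {r : Term}
           (vars  : ∀ x → r ⊵ var x → D m (σ x))
           (calls : ∀ {g us} → r ⊵ fun g us → ∀ k → m ≤ k → DV k (subs σ us) → D (H k) (fun g (subs σ us)))
           where
    mutual
      sub-D : ∀ u → r ⊵ u → D (bnd H m u) (sub σ u)
      sub-D (var x)    p = vars x p
      sub-D (fun g us) p = calls p _ (bnds-≥ H m us) (subs-DV us (λ i → ⊵-trans p (⊵-arg i ⊵-refl)))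

      subs-DV : ∀ {n} (us : Vec Term n) → (∀ i → r ⊵ lookup us i) → DV (bnds H m us) (subs σ us)
      subs-DV []       p = []
      subs-DV (u ∷ us) p = sub-D u (p zero) ∷ subs-DV us (p ∘ suc)

  lhs-defined : ∀ {ρ f ls} → ρ ∈ rules → lhs ρ ≡ fun f ls → Defined f
  lhs-defined {f = f} r eq = any⁺ _ (Any.map
    (λ { refl → subst (λ t → True (rootIs f t)) (sym eq) (fromWitness {a? = f Fin.≟ f} refl) }) r)

  same-root : ∀ {f ts t} → Star ArgMove (fun f ts) t → Σ (Vec Term (ar f)) λ ts′ → t ≡ fun f ts′
  same-root ε = _ , refl
  same-root (arg i s ◅ st) = same-root st

  -- Translating between plain and sharped terms

  mutual
    emb-sub : ∀ σ t → emb (sub σ t) ≡ ♯.sub (emb ∘ σ) (emb t)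
    emb-sub σ (var x)    = refl
    emb-sub σ (fun f ts) = cong (♯.fun (inj₁ f)) (embs-subs σ ts)

    embs-subs : ∀ {n} σ (ts : Vec Term n) → embs (subs σ ts) ≡ ♯.subs (emb ∘ σ) (embs ts)
    embs-subs σ []       = refl
    embs-subs σ (t ∷ ts) = cong₂ _∷_ (emb-sub σ t) (embs-subs σ ts)

  sharp-sub : ∀ {f} σ (ts : Vec Term (ar f)) → sharp (fun f (subs σ ts)) ≡ ♯.sub (emb ∘ σ) (sharp (fun f ts))
  sharp-sub σ ts = cong (♯.fun (inj₂ _)) (embs-subs σ ts)

  lookup-embs : ∀ {n} (ts : Vec Term n) i → lookup (embs ts) i ≡ emb (lookup ts i)
  lookup-embs (t ∷ ts) zero    = refl
  lookup-embs (t ∷ ts) (suc i) = lookup-embs ts i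

  embs-update : ∀ {n} (ts : Vec Term n) i t → embs (ts [ i ]≔ t) ≡ embs ts [ i ]≔ emb t
  embs-update (_ ∷ ts) zero    t = refl
  embs-update (s ∷ ts) (suc i) t = cong (emb s ∷_) (embs-update ts i t)

  mutual
    unsharp : Term♯ → Term
    unsharp (♯.var x)           = var x
    unsharp (♯.fun (inj₁ f) ts) = fun f (unsharps ts)
    unsharp (♯.fun (inj₂ f) ts) = fun f (unsharps ts)

    unsharps : ∀ {n} → Vec Term♯ n → Vec Term n
    unsharps []       = []
    unsharps (t ∷ ts) = unsharp t ∷ unsharps ts

  mutual
    unsharp-emb : ∀ t → unsharp (emb t) ≡ t
    unsharp-emb (var x)    = refl
    unsharp-emb (fun f ts) = cong (fun f) (unsharps-embs ts)

    unsharps-embs : ∀ {n} (ts : Vec Term n) → unsharps (embs ts) ≡ ts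
    unsharps-embs []       = refl
    unsharps-embs (t ∷ ts) = cong₂ _∷_ (unsharp-emb t) (unsharps-embs ts)

  unsharp-sharp : ∀ t → unsharp (sharp t) ≡ t
  unsharp-sharp (var x)    = refl
  unsharp-sharp (fun f ts) = cong (fun f) (unsharps-embs ts)

  sharp-injective : ∀ {s t} → sharp s ≡ sharp t → s ≡ t
  sharp-injective {s} {t} eq = trans (sym (unsharp-sharp s)) (trans (cong unsharp eq) (unsharp-sharp t))

  lookup-unsharps : ∀ {n} (ts : Vec Term♯ n) i → lookup (unsharps ts) i ≡ unsharp (lookup ts i)
  lookup-unsharps (t ∷ ts) zero    = refl
  lookup-unsharps (t ∷ ts) (suc i) = lookup-unsharps ts i

  unsharp-⊵ : ∀ {s t} → s ♯.⊵ t → unsharp s ⊵ unsharp t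
  unsharp-⊵ ♯.⊵-refl = ⊵-refl
  unsharp-⊵ (♯.⊵-arg {inj₁ f} {ts} i p) = ⊵-arg i (subst (_⊵ _) (sym (lookup-unsharps ts i)) (unsharp-⊵ p))
  unsharp-⊵ (♯.⊵-arg {inj₂ f} {ts} i p) = ⊵-arg i (subst (_⊵ _) (sym (lookup-unsharps ts i)) (unsharp-⊵ p))

  unsharp-▷ : ∀ {s t} → s ♯.▷ t → unsharp s ▷ unsharp t
  unsharp-▷ (♯.▷-arg {inj₁ f} {ts} i p) = ▷-arg i (subst (_⊵ _) (sym (lookup-unsharps ts i)) (unsharp-⊵ p))
  unsharp-▷ (♯.▷-arg {inj₂ f} {ts} i p) = ▷-arg i (subst (_⊵ _) (sym (lookup-unsharps ts i)) (unsharp-⊵ p))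

  unsharp-lookup-embs : ∀ {n} (ts : Vec Term n) i → unsharp (lookup (embs ts) i) ≡ lookup ts i
  unsharp-lookup-embs ts i = trans (cong unsharp (lookup-embs ts i)) (unsharp-emb _)

  emb-step : ∀ {s t} → s ⟶R t → ♯.Step R♯ (emb s) (emb t)
  emb-step (rootStep {ρ} r σ) = subst₂ (♯.Step R♯) (sym (emb-sub σ (lhs ρ))) (sym (emb-sub σ (rhs ρ)))
    (♯.rootStep (ρ , r , refl) (emb ∘ σ))
  emb-step (argStep {f} {ts} {t′} i s) = subst (♯.Step R♯ (emb (fun f ts)))
    (cong (♯.fun (inj₁ f)) (sym (embs-update ts i t′)))
    (♯.argStep {f = inj₁ f} i (subst (λ t → ♯.Step R♯ t (emb t′)) (sym (lookup-embs ts i)) (emb-step s)))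

  ArgMove-sharp : ∀ {s t} → ArgMove s t → ♯.Step R♯ (sharp s) (sharp t)
  ArgMove-sharp (arg {f} {ts} {t′} i s) = subst (♯.Step R♯ (sharp (fun f ts)))
    (cong (♯.fun (inj₂ f)) (sym (embs-update ts i t′)))
    (♯.argStep {f = inj₂ f} i (subst (λ t → ♯.Step R♯ t (emb t′)) (sym (lookup-embs ts i)) (emb-step s)))

  DPMove-sharp : ∀ {P s t} → DPMove P s t → ♯.Step P (sharp s) (sharp t)
  DPMove-sharp {P} (call {ls = ls} {us = us} p σ) =
    subst₂ (♯.Step P) (sym (sharp-sub σ ls)) (sym (sharp-sub σ us)) (♯.rootStep p (emb ∘ σ))

  ♯-Step-map : ∀ {P Q} → P ⊆ Q → ∀ {s t} → ♯.Step P s t → ♯.Step Q s t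
  ♯-Step-map h (♯.rootStep p σ) = ♯.rootStep (h _ p) σ
  ♯-Step-map h (♯.argStep i s)  = ♯.argStep i (♯-Step-map h s)

  Move-sharp : ∀ {P s t} → Move P s t → ♯.Step (R♯ ∪ P) (sharp s) (sharp t)
  Move-sharp (inj₁ a) = ♯-Step-map (λ _ → inj₁) (ArgMove-sharp a)
  Move-sharp (inj₂ c) = ♯-Step-map (λ _ → inj₂) (DPMove-sharp c)

  IsDP-defined : ∀ {f ls u} → IsDP (sharp (fun f ls) ♯.⟶ u) → Defined f
  IsDP-defined (ρ , r , _ , _ , _ , _ , eq) = lhs-defined r (sym (sharp-injective (cong ♯.lhs eq)))

  -- Two applications, because at level 0 `T-twice` needs both to absorb x + 1 iterations.
  ⟦_⟧ : ℕ → (ℕ → ℕ) → ℕ → ℕ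
  ⟦ d ⟧ H = T d (T d H)

  -- Bounding the calls made through a set of dependency pairs

  module Bound (g b : ℕ → ℕ) (C : ℕ)
    (4≤C : 4 ≤ C)
    (weight≤C : ∀ {ρ} → ρ ∈ rules → 2 + weight (rhs ρ) ≤ C)
    (b-growing : Growing b)
    (b-double : ∀ {x} → C ≤ x → x + x ≤ b x)
    (g≤b : ∀ {x} → C ≤ x → g x ≤ b x)
    where

    -- Lying above `b` gives `H` the doubling property and room for the values of `g`, and it
    -- survives all applications of `T`.
    record Nice (H : ℕ → ℕ) : Set where
      constructor nice
      field
        growing : Growing H
        b≤      : ∀ x → b x ≤ H x
    open Nice

    double : ∀ {H} → Nice H → ∀ {x} → C ≤ x → x + x ≤ H x
    double nH le = ≤-trans (b-double le) (b≤ nH _)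

    T-nice : ∀ d {H} → Nice H → Nice (T d H)
    T-nice d nH = nice (T-growing d (growing nH)) (λ x → ≤-trans (b≤ nH x) (T-≥ d (growing nH) x))

    T^-nice : ∀ d n {H} → Nice H → Nice (T d ^[ n ] H)
    T^-nice d zero    nH = nH
    T^-nice d (suc n) nH = T-nice d (T^-nice d n nH)

    ⟦⟧-nice : ∀ d {H} → Nice H → Nice (⟦ d ⟧ H)
    ⟦⟧-nice d = T^-nice d 2

    ⟦⟧^-nice : ∀ d n {H} → Nice H → Nice (⟦ d ⟧ ^[ n ] H)
    ⟦⟧^-nice d zero    nH = nH
    ⟦⟧^-nice d (suc n) nH = ⟦⟧-nice d (⟦⟧^-nice d n nH)

    ⟦⟧-≥ : ∀ d {H} → Nice H → ∀ x → H x ≤ ⟦ d ⟧ H x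
    ⟦⟧-≥ d nH x = ≤-trans (T-≥ d (growing nH) x) (T-≥ d (growing (T-nice d nH)) x)

    ⟦⟧^-≥ : ∀ d n {H} → Nice H → ∀ x → H x ≤ (⟦ d ⟧ ^[ n ] H) x
    ⟦⟧^-≥ d zero    nH x = ≤-refl
    ⟦⟧^-≥ d (suc n) nH x = ≤-trans (⟦⟧^-≥ d n nH x) (⟦⟧-≥ d (⟦⟧^-nice d n nH) x)

    ⟦⟧^-T : ∀ d n H → ⟦ d ⟧ ^[ n ] H ≡ T d ^[ n + n ] H
    ⟦⟧^-T d zero    H = refl
    ⟦⟧^-T d (suc n) H = trans (cong ⟦ d ⟧ (⟦⟧^-T d n H)) (cong (λ k → T d (T d ^[ k ] H)) (sym (+-suc n n)))

    ⟦⟧-iterate : ∀ d {H n x} → Nice H → C ≤ x → n ≤ suc x → H ^[ n ] x ≤ ⟦ d ⟧ H x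
    ⟦⟧-iterate d {x = x} nH le n≤ = ≤-trans (^-monoˡ (growing nH) x n≤)
      (T-twice d (growing nH) (≤-trans (s≤s (s≤s z≤n)) (≤-trans 4≤C le)))

    -- The m + 1 phases cost T d ^[ 2m + 2 ] H, which T (suc d) absorbs by diagonalising at 2m + 2 ≤ H ^[ 4 ] x.
    ⟦⟧^-diag : ∀ d {H m x} → Nice H → C ≤ x → m ≤ b (suc x) → (⟦ d ⟧ ^[ suc m ] H) x ≤ ⟦ suc d ⟧ H x
    ⟦⟧^-diag d {H} {m} {x} nH C≤x m≤ = begin
      (⟦ d ⟧ ^[ suc m ] H) x          ≡⟨ cong (λ F → F x) (⟦⟧^-T d (suc m) H) ⟩
      (T d ^[ suc m + suc m ] H) x    ≤⟨ T^-monoˡ d gH steps x ⟩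
      (T d ^[ X ] H) x                ≤⟨ mono (T^-growing d X gH) (≤-trans (m≤n+m x 4) (^-infl gH 4 x)) ⟩
      T (suc d) H X                   ≤⟨ mono gT (^-≤ gT (T-≥ (suc d) gH) 4 x) ⟩
      T (suc d) H ^[ 5 ] x            ≤⟨ ^-monoˡ gT x (s≤s (≤-trans 4≤C C≤x)) ⟩
      T (suc d) H ^[ suc x ] x        ≤⟨ T-twice-suc d gH (≤-trans (s≤s (s≤s z≤n)) (≤-trans 4≤C C≤x)) ⟩
      ⟦ suc d ⟧ H x                   ∎
      where
      open ≤-Reasoning
      gH = growing nH
      gT = T-growing (suc d) gH
      X = H ^[ 4 ] x
      m≤HH : m ≤ H ^[ 2 ] x
      m≤HH = ≤-trans m≤ (≤-trans (b≤ nH _) (mono gH (infl gH x)))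
      steps : suc m + suc m ≤ X
      steps = begin
        suc m + suc m              ≤⟨ +-mono-≤ (≤-trans (s≤s m≤HH) (infl gH _)) (≤-trans (s≤s m≤HH) (infl gH _)) ⟩
        H ^[ 3 ] x + H ^[ 3 ] x    ≤⟨ double nH (≤-trans C≤x (≤-trans (m≤n+m x 3) (^-infl gH 3 x))) ⟩
        X                          ∎

    -- Only argument costs from `C` on are considered, where the numerical estimates hold. A
    -- variable is not a call.
    G : (ℕ → ℕ) → Term → Set
    G H (var x)    = ⊤
    G H (fun f ts) = ∀ m → C ≤ m → DV m ts → D (H m) (fun f ts)

    G-stable : ∀ {H} t → Stable (G H t)
    G-stable (var x)    _ = tt
    G-stable (fun f ts) nn m le ds = D-stable (λ ¬d → nn (λ h → ¬d (h m le ds)))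

    G-mono : ∀ {H K} t → (∀ {x} → C ≤ x → H x ≤ K x) → G H t → G K t
    G-mono (var x)    le h = tt
    G-mono (fun f ts) le h m C≤m ds = D-mono (le C≤m) (h m C≤m ds)

    Exits : Pred♯ → (ℕ → ℕ) → Term → Set
    Exits P H s = ∀ {s′ w} → Star (Move P) s s′ → DPMove (IsDP ∖ P) s′ w → G H w

    -- Here d stands for the number of elements of P.
    record Good (d : ℕ) (P : Pred♯) : Set where
      constructor good
      field
        calls-bounded : ∀ {H} → Nice H → ∀ s → Exits P H s → G (⟦ d ⟧ H) s
    open Good

    Good-stable : ∀ {d P} → Stable (Good d P)
    Good-stable nn = good λ nH s ex → G-stable s (λ ¬h → nn (λ h → ¬h (calls-bounded h nH s ex)))

    -- A subterm of the right-hand side is a proper subterm of the left-hand side, hence bounded by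
    -- the arguments; or it has an undefined root, hence no root step; or it yields a dependency
    -- pair, to which the hypothesis applies.
    rhs-D : ∀ {H ρ σ m f ls} → Growing H → ρ ∈ rules → lhs ρ ≡ fun f ls → C ≤ m → DV m (subs σ ls)
          → (∀ {w} → DPMove IsDP (fun f (subs σ ls)) w → G H w)
          → D (bnd H m (rhs ρ)) (sub σ (rhs ρ))
    rhs-D {H} {l ⟶ r} {σ} {m} {f} {ls} gH ρ∈ refl C≤m ds h = sub-D vars calls r ⊵-refl
      where
      inner : ∀ {u} → fun f ls ▷ u → D m (sub σ u)
      inner (▷-arg i p) = D-⊵ (sub-⊵ σ p) (subst (D m) (lookup-subs σ ls i) (DV-lookup ds i))
      vars : ∀ x → r ⊵ var x → D m (σ x)
      vars x p with ⊵-arg i q ← proj₂ (All.lookup wf ρ∈) x p = inner (▷-arg i q)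
      calls : ∀ {g us} → r ⊵ fun g us → ∀ k → m ≤ k → DV k (subs σ us) → D (H k) (fun g (subs σ us))
      calls {g} {us} p k m≤k dus = by-cases (fun f ls ▷ fun g us) D-stable
        (λ q → D-mono (≤-trans m≤k (<⇒≤ (infl gH k))) (inner q))
        (λ ¬q → case-defined ¬q (T? _))
        where
        case-defined : ¬ (fun f ls ▷ fun g us) → Dec (Defined g) → D (H k) (fun g (subs σ us))
        case-defined ¬q (yes def) =
          h (call ((l ⟶ r) , ρ∈ , fun g us , p , ¬q , (g , us , refl , def) , refl) σ) k (≤-trans C≤m m≤k) dus
        case-defined ¬q (no ¬def) = D-mono (≤-trans (≤-reflexive (cong suc (+-identityʳ k))) (infl gH k))
          (D-fun {n = 0} dus λ {ρ′} ρ′∈ τ st → ⊥-elim (undefined ρ′ ρ′∈ τ st))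
          where
          undefined : ∀ ρ′ → ρ′ ∈ rules → ∀ τ → Star ArgMove (fun g (subs σ us)) (sub τ (lhs ρ′)) → ⊥
          undefined (var x ⟶ _) ρ′∈ τ st = proj₁ (All.lookup wf ρ′∈) x refl
          undefined (fun g′ vs ⟶ _) ρ′∈ τ st with _ , refl ← same-root st = ¬def (lhs-defined ρ′∈ refl)

    call-step : ∀ d {H} → Nice H → ∀ s → (∀ {s′ w} → Star ArgMove s s′ → DPMove IsDP s′ w → G H w) → G (⟦ d ⟧ H) s
    call-step d nH (var x) h = tt
    call-step d {H} nH (fun f ts) h m C≤m ds k u c =
      ≤-trans (D-fun {n = H ^[ C-2 ] m} ds root k u c) bound
      where
      open ≤-Reasoning
      gH = growing nH
      -- Weights of right-hand sides are at most C - 2; the two iterations held back absorb the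
      -- argument steps and the root step.
      C-2 = pred (pred C)
      2+C-2 : 2 + C-2 ≡ C
      2+C-2 = go 4≤C
        where
        go : ∀ {c} → 4 ≤ c → 2 + pred (pred c) ≡ c
        go (s≤s (s≤s _)) = refl
      root : ∀ {ρ} → ρ ∈ rules → ∀ σ → Star ArgMove (fun f ts) (sub σ (lhs ρ)) → D (H ^[ C-2 ] m) (sub σ (rhs ρ))
      root {var x ⟶ r} ρ∈ σ st = ⊥-elim (proj₁ (All.lookup wf ρ∈) x refl)
      root {fun f′ ls ⟶ r} ρ∈ σ st = D-mono
        (≤-trans (bnd-≤ gH (λ le → double nH (≤-trans C≤m le)) r)
                 (^-monoˡ gH m (pred-mono-≤ (pred-mono-≤ (weight≤C ρ∈)))))
        (rhs-D gH ρ∈ refl C≤m (ArgsD-moves st ds) (h st))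
      m≤ : m ≤ H ^[ C-2 ] m
      m≤ = ≤-trans (m≤n+m m C-2) (^-infl gH C-2 m)
      bound : suc (m + H ^[ C-2 ] m) ≤ ⟦ d ⟧ H m
      bound = begin
        suc (m + H ^[ C-2 ] m)                 ≤⟨ s≤s (+-monoˡ-≤ _ m≤) ⟩
        suc (H ^[ C-2 ] m + H ^[ C-2 ] m)      ≤⟨ s≤s (double nH (≤-trans C≤m m≤)) ⟩
        suc (H ^[ suc C-2 ] m)                 ≤⟨ infl gH _ ⟩
        H ^[ 2 + C-2 ] m                       ≤⟨ ⟦⟧-iterate d nH C≤m (≤-trans (≤-reflexive 2+C-2) (m≤n⇒m≤1+n C≤m)) ⟩
        ⟦ d ⟧ H m                              ∎

    empty-good : ∀ {d P} → (∀ ρ → ¬ P ρ) → Good d P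
    empty-good {d} {P} ¬P = good λ nH s ex → call-step d nH s λ st mv →
      ex (Star.map inj₁ st) (DPMove-map (λ ρ p → p , ¬P ρ) mv)

    -- M m s: at most m further pairs of P ∖ P′ can be used from s on.
    descend : ∀ {d P P′} (M : ℕ → Term → Set)
            → (∀ {m s t} → M m s → Move P′ s t → M m t)
            → (∀ {m s t} → M m s → DPMove (P ∖ P′) s t → Σ ℕ λ m′ → m ≡ suc m′ × M m′ t)
            → (∀ {f ts n} → C ≤ n → DV n ts → Σ ℕ λ m → m ≤ b (suc n) × M m (fun f ts))
            → P′ ⊆ P → Good d P′ → Good (suc d) P
    descend {d} {P} {P′} M weak strict init P′⊆P good′ = good top
      where
      along : ∀ {m s t} → Star (Move P′) s t → M m s → M m t
      along ε         μ = μ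
      along (mv ◅ st) μ = along st (weak μ mv)

      -- An exit from `P′` through a pair of `P` starts a phase with a smaller `m`, whose bound is
      -- the exit bound of the current phase; an exit from `P` itself is bounded by `H`.
      phases : ∀ {H} → Nice H → ∀ m s → M m s → Exits P H s → G (⟦ d ⟧ ^[ suc m ] H) s
      phases {H} nH m s μ ex = calls-bounded good′ (⟦⟧^-nice d m nH) s exits
        where
        exits : Exits P′ (⟦ d ⟧ ^[ m ] H) s
        exits {w = w} st (call {f} {ls} {g′} {us} (dp , ¬p′) σ) = by-cases (P ρ) (G-stable w)
          (λ p → next p (strict (along st μ) (call (p , ¬p′) σ)))
          (λ ¬p → G-mono w (λ _ → ⟦⟧^-≥ d m nH _) (ex (Star.map (Move-map P′⊆P) st) (call (dp , ¬p) σ)))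
          where
          ρ = sharp (fun f ls) ♯.⟶ sharp (fun g′ us)
          next : P ρ → (Σ ℕ λ m′ → m ≡ suc m′ × M m′ w) → G (⟦ d ⟧ ^[ m ] H) w
          next p (m′ , refl , μ′) = phases nH m′ w μ′
            (λ st′ → ex (Star.map (Move-map P′⊆P) st ◅◅ (inj₂ (call p σ) ◅ st′)))

      top : ∀ {H} → Nice H → ∀ s → Exits P H s → G (⟦ suc d ⟧ H) s
      top nH (var x)    ex = tt
      top nH (fun f ts) ex n C≤n ds with m , m≤ , μ ← init C≤n ds =
        D-mono (⟦⟧^-diag d nH C≤n m≤) (phases nH m (fun f ts) μ ex n C≤n ds)

    EdgeR : Rule♯ → Rule♯ → Set
    EdgeR ρ ρ′ = Σ ♯.Subst λ σ → Σ ♯.Subst λ τ → Star (♯.Step R♯) (♯.sub σ (♯.rhs ρ)) (♯.sub τ (♯.lhs ρ′))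

    -- A chain leaving `P₁` inside `P` has last used a pair outside `P₁`, and by disjointness this
    -- stays so while it uses `P₂`. A later pair of `P` outside `P₂` would give a forbidden edge, so
    -- two nested bounds suffice.
    sequence : ∀ {d P P₁ P₂} → P₁ ⊆ P → P₂ ⊆ P → (∀ {ρ} → P₂ ρ → ¬ P₁ ρ)
             → (∀ {ρ ρ′} → P ρ → ¬ P₁ ρ → P ρ′ → ¬ P₂ ρ′ → ¬ EdgeR ρ ρ′)
             → Good d P₁ → Good d P₂ → Good (suc d) P
    sequence {d} {P} {P₁} {P₂} P₁⊆P P₂⊆P disjoint noedge good₁ good₂ = good λ nH s ex →
      G-mono s (λ {x} C≤x → ⟦⟧^-diag d nH C≤x (≤-trans (s≤s z≤n) (infl b-growing (suc x))))
        (calls-bounded good₁ (⟦⟧-nice d nH) s (exits₁ nH ex))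
      where
      -- The last pair used is remembered with its instance, from which the edge to the next pair is
      -- built.
      Reached : Term → Set
      Reached t = Σ Rule♯ λ ρ → P ρ × ¬ P₁ ρ × Σ ♯.Subst λ σ → Star (♯.Step R♯) (♯.sub σ (♯.rhs ρ)) (sharp t)

      reached : ∀ {t u} → Reached t → Star (Move P₂) t u → Reached u
      reached r ε = r
      reached (ρ , p , ¬p₁ , σ , rs) (inj₁ a ◅ st) = reached (ρ , p , ¬p₁ , σ , rs ◅◅ (ArgMove-sharp a ◅ ε)) st
      reached _ (inj₂ (call {us = us} p₂ σ) ◅ st) =
        reached (_ , P₂⊆P _ p₂ , disjoint p₂ , emb ∘ σ , subst (Star _ _) (sym (sharp-sub σ us)) ε) st

      exits₁ : ∀ {H s} → Nice H → Exits P H s → Exits P₁ (⟦ d ⟧ H) s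
      exits₁ {H} nH ex {w = w} st (call {f} {ls} {g′} {us} (dp , ¬p₁) σ) = by-cases (P ρ) (G-stable w) crossing
        (λ ¬p → G-mono w (λ _ → ⟦⟧-≥ d nH _) (ex (Star.map (Move-map P₁⊆P) st) (call (dp , ¬p) σ)))
        where
        ρ = sharp (fun f ls) ♯.⟶ sharp (fun g′ us)
        crossing : P ρ → G (⟦ d ⟧ H) w
        crossing p = calls-bounded good₂ nH w exits₂
          where
          exits₂ : Exits P₂ H w
          exits₂ {w = v} st′ (call {ls = ls′} (dp′ , ¬p₂) τ) = by-cases (P _) (G-stable v)
            (λ p′ → let start = ρ , p , ¬p₁ , emb ∘ σ , subst (Star _ _) (sym (sharp-sub σ us)) ε
                        ρ″ , p″ , ¬p₁″ , σ″ , rs = reached start st′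
                    in ⊥-elim (noedge p″ ¬p₁″ p′ ¬p₂ (σ″ , emb ∘ τ , subst (Star _ _) (sharp-sub τ ls′) rs)))
            (λ ¬p′ → ex (Star.map (Move-map P₁⊆P) st ◅◅ (inj₂ (call p σ) ◅ Star.map (Move-map P₂⊆P) st′))
                        (call (dp′ , ¬p′) τ))

    _∩_ : Pred♯ → Pred♯ → Pred♯
    (P ∩ Q) ρ = P ρ × Q ρ

    ∁ : Pred♯ → Pred♯
    ∁ P ρ = ¬ P ρ

    -- The measure is the relative derivation height: all other moves are relative steps and every
    -- removed pair is a strict one. The size of a call is at most one more than the cost of its
    -- arguments, so `g` at n + 1 bounds it initially.
    rp-good : ∀ {d P P₀ Q} → P ⊆ P₀
            → (∀ n (s : Term) → size s ≤ n → DhBound (Rel (P₀ ∖ Q) (R♯ ∪ Q)) (sharp s) (g n))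
            → Good d (P ∩ Q) → Good (suc d) P
    rp-good {P = P} {P₀} {Q} P⊆P₀ bound = descend M weak strict init (λ _ → proj₁)
      where
      Strict = Rel (P₀ ∖ Q) (R♯ ∪ Q)
      M : ℕ → Term → Set
      M m s = DhBound Strict (sharp s) m
      weak : ∀ {m s t} → M m s → Move (P ∩ Q) s t → M m t
      weak μ mv zero    u done = z≤n
      weak μ mv (suc k) u (step (s′ , t′ , ws , st , ws′) c) =
        μ (suc k) u (step (s′ , t′ , Move-sharp (Move-map (λ _ → proj₂) mv) ◅ ws , st , ws′) c)
      rel : ∀ {s t} → DPMove (P ∖ (P ∩ Q)) s t → Strict (sharp s) (sharp t)
      rel c = _ , _ , ε , DPMove-sharp (DPMove-map (λ ρ (p , ¬pq) → P⊆P₀ ρ p , λ q → ¬pq (p , q)) c) , ε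
      strict : ∀ {m s t} → M m s → DPMove (P ∖ (P ∩ Q)) s t → Σ ℕ λ m′ → m ≡ suc m′ × M m′ t
      strict {zero} μ c with () ← μ 1 _ (step (rel c) done)
      strict {suc m} μ c = m , refl , λ k u ch → s≤s⁻¹ (μ (suc k) u (step (rel c) ch))
      init : ∀ {f ts n} → C ≤ n → DV n ts → Σ ℕ λ m → m ≤ b (suc n) × M m (fun f ts)
      init {f} {ts} {n} C≤n ds =
        g (suc n) , g≤b (m≤n⇒m≤1+n C≤n) , bound (suc n) (fun f ts) (s≤s (DV-sizes ds))

    -- The measure is the cost of the projected argument: reduction and the pairs kept never raise
    -- it, and a removed pair passes to a proper subterm, which is strictly cheaper.
    sc-good : ∀ {d P P₀ Q} → P₀ ⊆ IsDP → P ⊆ P₀ → ∀ π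
            → (∀ ρ → Q ρ → ∀ a b → ProjOf π (♯.lhs ρ) a → ProjOf π (♯.rhs ρ) b → a ♯.⊵ b)
            → (∀ ρ → (P₀ ∖ Q) ρ → ∀ a b → ProjOf π (♯.lhs ρ) a → ProjOf π (♯.rhs ρ) b → a ♯.▷ b)
            → Good d (P ∩ Q) → Good (suc d) P
    sc-good {P = P} {P₀} {Q} P₀⊆DP P⊆P₀ π weak⊵ strict▷ = descend M weak strict init (λ _ → proj₁)
      where
      M : ℕ → Term → Set
      M m (var x)    = ⊤
      M m (fun f ts) = ∀ (def : Defined f) → D m (lookup ts (π f def))

      projOf : ∀ {f ts} (def : Defined f) → ProjOf π (sharp (fun f ts)) (lookup (embs ts) (π f def))
      projOf def = _ , _ , refl , def , refl

      at-lhs : ∀ {m f ls u} σ → IsDP (sharp (fun f ls) ♯.⟶ u) → M m (fun f (subs σ ls))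
             → Σ (Defined f) λ def → D m (sub σ (lookup ls (π f def)))
      at-lhs {m} {f} {ls} σ dp μ =
        IsDP-defined dp , subst (D m) (lookup-subs σ ls _) (μ (IsDP-defined dp))

      weak : ∀ {m s t} → M m s → Move (P ∩ Q) s t → M m t
      weak {m} μ (inj₁ (arg {ts = ts} {t} i st)) def with π _ def Fin.≟ i
      ... | yes refl = subst (D m) (sym (lookup∘update i ts t))
                         (λ k u c → ≤-trans (n≤1+n _) (μ def (suc k) u (step st c)))
      ... | no π≢i   = subst (D m) (sym (lookup∘update′ π≢i ts t)) (μ def)
      weak {m} μ (inj₂ (call {f} {ls} {g′} {us} (p , q) σ)) def
        with defl , dl ← at-lhs {u = sharp (fun g′ us)} σ (P₀⊆DP _ (P⊆P₀ _ p)) μ =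
        subst (D m) (sym (lookup-subs σ us _)) (D-⊵ (sub-⊵ σ l⊵u) dl)
        where
        l⊵u : lookup ls (π f defl) ⊵ lookup us (π g′ def)
        l⊵u = subst₂ _⊵_ (unsharp-lookup-embs ls _) (unsharp-lookup-embs us _)
                (unsharp-⊵ (weak⊵ _ q _ _ (projOf defl) (projOf def)))

      strict : ∀ {m s t} → M m s → DPMove (P ∖ (P ∩ Q)) s t → Σ ℕ λ m′ → m ≡ suc m′ × M m′ t
      strict {m} μ (call {f} {ls} {g′} {us} (p , ¬pq) σ)
        with defl , dl ← at-lhs {u = sharp (fun g′ us)} σ (P₀⊆DP _ (P⊆P₀ _ p)) μ
        with m′ , refl ← D-pos dl =
        m′ , refl , λ def → subst (D m′) (sym (lookup-subs σ us _)) (D-▷ (sub-▷ σ (l▷u def)) dl)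
        where
        l▷u : ∀ def → lookup ls (π f defl) ▷ lookup us (π g′ def)
        l▷u def = subst₂ _▷_ (unsharp-lookup-embs ls _) (unsharp-lookup-embs us _)
                (unsharp-▷ (strict▷ _ (P⊆P₀ _ p , λ q → ¬pq (p , q)) _ _ (projOf defl) (projOf def)))

      init : ∀ {f ts n} → C ≤ n → DV n ts → Σ ℕ λ m → m ≤ b (suc n) × M m (fun f ts)
      init {n = n} C≤n ds = n , ≤-trans (n≤1+n n) (<⇒≤ (infl b-growing (suc n))) , λ def → DV-lookup ds _

    -- A covering list instead of an enumeration, since membership in `P` need not be decidable.
    Card : ℕ → Pred♯ → Set
    Card d P = Σ (List Rule♯) λ l → length l ≤ d × (∀ {ρ} → P ρ → ρ ∈ l)

    Card-drop : ∀ {d P P′ ρ₀} → P′ ⊆ P → P ρ₀ → ¬ P′ ρ₀ → Card (suc d) P → Card d P′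
    Card-drop {P′ = P′} P′⊆P p₀ ¬p₀ (l , len , mem) with l′ , eq , rest ← remove (mem p₀) =
      l′ , s≤s⁻¹ (≤-trans (≤-reflexive (sym eq)) len) , λ {ρ} p → keep p (rest (mem (P′⊆P ρ p)))
      where
      keep : ∀ {ρ} → P′ ρ → ρ ≡ _ ⊎ ρ ∈ l′ → ρ ∈ l′
      keep p (inj₁ refl) = ⊥-elim (¬p₀ p)
      keep p (inj₂ i)    = i

    -- Classical case distinction for a stable goal; the covering list makes the universal case
    -- reachable through `¬¬-shift`.
    dichotomy : ∀ {d P} {X : Set} (Q : Pred♯) → Card d P → Stable X
              → (P ⊆ Q → X) → (∀ ρ → P ρ → ¬ Q ρ → X) → X
    dichotomy {P = P} Q (l , _ , mem) st f h = st λ ¬x →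
      ¬¬-shift l (λ ρ ¬pq → ¬pq λ p → ⊥-elim (¬x (h ρ p λ q → ¬pq λ _ → q)))
              (λ all → ¬x (f λ ρ p → all (mem p) p))

    -- Fix a node x of `P`. If some pair of `P` is not reachable from x, or does not reach x, then
    -- `P` splits into two smaller parts. Otherwise `P` lies in the component of x: a nontrivial one
    -- is a child of the proof tree, and a trivial one has no edges, so that `sequence` applies with
    -- two empty parts.
    dg-good : ∀ {d P P₀} → P ⊆ P₀ → Card (suc d) P
            → (∀ P′ → P′ ⊆ P₀ → Card d P′ → Good d P′)
            → (∀ Q → NontrivSCC P₀ Q → P ⊆ Q → Good (suc d) P)
            → Good (suc d) P
    dg-good {d} {P} {P₀} P⊆P₀ card smaller within = dichotomy (λ _ → ⊥) card Good-stable
      empty-good (λ x p _ → from-node x p)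
      where
      from-node : ∀ x → P x → Good (suc d) P
      from-node x px = dichotomy Reach card Good-stable
        (λ P⊆R → dichotomy CoReach card Good-stable (same-scc P⊆R) split-coreach)
        split-reach
        where
        x₀ : Node P₀
        x₀ = x , P⊆P₀ x px
        Reach CoReach : Pred♯
        Reach   ρ = Σ (P₀ ρ) λ p → Star (Edge P₀) x₀ (ρ , p)
        CoReach ρ = Σ (P₀ ρ) λ p → Star (Edge P₀) (ρ , p) x₀

        restrict : ∀ Q {ρ} → P ρ → ¬ Q ρ → Good d (P ∩ Q)
        restrict Q p ¬q = smaller (P ∩ Q) (λ ρ pq → P⊆P₀ ρ (proj₁ pq))
          (Card-drop {P′ = P ∩ Q} (λ _ → proj₁) p (λ pq → ¬q (proj₂ pq)) card)

        -- The unreachable part comes first, as no edge leads back to it from the reachable part.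
        split-reach : ∀ ρ → P ρ → ¬ Reach ρ → Good (suc d) P
        split-reach ρ p ¬r = sequence {P₁ = P ∩ ∁ Reach} {P ∩ Reach} (λ _ → proj₁) (λ _ → proj₁)
          (λ pr p¬r → proj₂ p¬r (proj₂ pr))
          (λ p₁ ¬¬r p₂ ¬r′ e → ¬¬r (p₁ , λ { (q , st) → ¬r′ (p₂ , P⊆P₀ _ p₂ , st ◅◅ (e ◅ ε)) }))
          (restrict (∁ Reach) px (λ ¬r₀ → ¬r₀ (P⊆P₀ x px , ε)))
          (restrict Reach p ¬r)

        split-coreach : ∀ ρ → P ρ → ¬ CoReach ρ → Good (suc d) P
        split-coreach ρ p ¬r = sequence {P₁ = P ∩ CoReach} {P ∩ ∁ CoReach} (λ _ → proj₁) (λ _ → proj₁)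
          (λ p¬r pr → proj₂ p¬r (proj₂ pr))
          (λ p₁ ¬r′ p₂ ¬¬r e → ¬¬r (p₂ , λ { (q , st) → ¬r′ (p₁ , P⊆P₀ _ p₁ , e ◅ st) }))
          (restrict CoReach p ¬r)
          (restrict (∁ CoReach) px (λ ¬r₀ → ¬r₀ (P⊆P₀ x px , ε)))

        same-scc : P ⊆ Reach → P ⊆ CoReach → Good (suc d) P
        same-scc P⊆R P⊆CR = by-cases (Plus (Edge P₀) x₀ x₀) Good-stable nontrivial trivial
          where
          SCC : Pred♯
          SCC ρ = Σ (P₀ ρ) λ p → SameSCC P₀ x₀ (ρ , p)
          nontrivial : Plus (Edge P₀) x₀ x₀ → Good (suc d) P
          nontrivial cycle = within SCC (x₀ , cycle , (λ _ s → s) , (λ _ p s → p , s))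
            (λ ρ p → join (P⊆R ρ p) (P⊆CR ρ p))
            where
            -- a node carries its membership proof, but whether an edge leaves it depends on the rule only
            join : ∀ {ρ} → Reach ρ → CoReach ρ → SCC ρ
            join _        (q , ε)      = q , ε , ε
            join (q , st) (_ , e ◅ st′) = q , st , e ◅ st′
          plus : ∀ {a b c z} → Star (Edge P₀) a b → Edge P₀ b c → Star (Edge P₀) c z → Plus (Edge P₀) a z
          plus ε e ε                           = one e
          plus {b = b} {c} ε e (e′ ◅ st′)      = _∷⁺_ {a = b} {c} e (plus {b = c} ε e′ st′)
          plus {b = b} {c} (e′ ◅ st) e st′     = e′ ∷⁺ plus {b = b} {c} st e st′
          trivial : ¬ Plus (Edge P₀) x₀ x₀ → Good (suc d) P
          trivial acyclic = sequence {P₁ = λ _ → ⊥} {λ _ → ⊥} (λ _ ()) (λ _ ()) (λ ())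
            (λ p _ p′ _ e → acyclic (plus (proj₂ (P⊆R _ p)) e (proj₂ (P⊆CR _ p′))))
            (empty-good λ _ ()) (empty-good λ _ ())

    -- Subsets `P` of the node are allowed because splitting and removal produce sets that label no
    -- node. Either `d` drops, or `P` fits into a child and the tree shrinks.
    proof-tree-good : ∀ d {P₀} (t : PT P₀) → IsRPF g t → P₀ ⊆ IsDP → ∀ P → P ⊆ P₀ → Card d P → Good d P
    proof-tree-good zero t rpf P₀⊆DP P P⊆P₀ ([] , _ , mem) = empty-good λ ρ p → case-[] (mem p)
      where
      case-[] : ∀ {ρ : Rule♯} → ρ ∈ [] → ⊥
      case-[] ()
    proof-tree-good (suc d) (leaf ¬P₀) fLeaf P₀⊆DP P P⊆P₀ card = empty-good λ ρ p → ¬P₀ ρ (P⊆P₀ ρ p)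
    proof-tree-good (suc d) (rpStep rp Q Q⊆DP _ _ _ t) (fRP bound rpf) P₀⊆DP P P⊆P₀ card =
      dichotomy Q card Good-stable
        (λ P⊆Q → proof-tree-good (suc d) t rpf Q⊆DP P P⊆Q card)
        (λ ρ p ¬q → rp-good P⊆P₀ bound (proof-tree-good d t rpf Q⊆DP (P ∩ Q) (λ _ → proj₂)
          (Card-drop {P′ = P ∩ Q} (λ _ → proj₁) p (λ pq → ¬q (proj₂ pq)) card)))
    proof-tree-good (suc d) (scStep π Q Q⊆DP weak strict t) (fSC rpf) P₀⊆DP P P⊆P₀ card =
      dichotomy Q card Good-stable
        (λ P⊆Q → proof-tree-good (suc d) t rpf Q⊆DP P P⊆Q card)
        (λ ρ p ¬q → sc-good P₀⊆DP P⊆P₀ π weak strict (proof-tree-good d t rpf Q⊆DP (P ∩ Q) (λ _ → proj₂)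
          (Card-drop {P′ = P ∩ Q} (λ _ → proj₁) p (λ pq → ¬q (proj₂ pq)) card)))
    proof-tree-good (suc d) (dgStep k) (fDG sccs rpf) P₀⊆DP P P⊆P₀ card = dg-good P⊆P₀ card
      (λ P′ P′⊆P₀ card′ → proof-tree-good d (dgStep k) (fDG sccs rpf) P₀⊆DP P′ P′⊆P₀ card′)
      (λ Q scc P⊆Q → proof-tree-good (suc d) (k Q scc) (rpf Q scc)
        (λ ρ q → P₀⊆DP ρ (proj₁ (proj₁ (proj₂ (proj₂ scc)) ρ q))) P P⊆Q card)

  -- Finiteness of the set of dependency pairs

  mutual
    subterms : Term → List Term
    subterms (var x)    = var x ∷ []
    subterms (fun f ts) = fun f ts ∷ subtermss ts

    subtermss : ∀ {n} → Vec Term n → List Term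
    subtermss []       = []
    subtermss (t ∷ ts) = subterms t List.++ subtermss ts

  mutual
    ∈-subterms : ∀ {u} t → t ⊵ u → u ∈ subterms t
    ∈-subterms (var x)    ⊵-refl      = here refl
    ∈-subterms (fun f ts) ⊵-refl      = here refl
    ∈-subterms (fun f ts) (⊵-arg i p) = there (∈-subtermss ts i p)

    ∈-subtermss : ∀ {n u} (ts : Vec Term n) i → lookup ts i ⊵ u → u ∈ subtermss ts
    ∈-subtermss (t ∷ ts) zero    p = ∈-++⁺ˡ (∈-subterms t p)
    ∈-subtermss (t ∷ ts) (suc i) p = ∈-++⁺ʳ (subterms t) (∈-subtermss ts i p)

  -- All subterms of the right-hand side are listed: `Card` only asks for an over-approximation.
  candidatesFor : Rule → List Rule♯
  candidatesFor ρ = List.map (λ u → sharp (lhs ρ) ♯.⟶ sharp u) (subterms (rhs ρ))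

  candidates : List Rule♯
  candidates = List.concatMap candidatesFor rules

  IsDP-candidate : ∀ {ρ♯} → IsDP ρ♯ → ρ♯ ∈ candidates
  IsDP-candidate (ρ , ρ∈ , u , p , _ , _ , refl) =
    ∈-concatMap⁺ candidatesFor (Any.map (λ { refl → ∈-map⁺ _ (∈-subterms (rhs ρ) p) }) ρ∈)

  -- The bound on derivational complexity

  dc-bounded : (t : ProofTree) (g : ℕ → ℕ) → ReductionPairFunction t g → MultRec g
             → Σ (ℕ → ℕ) λ h → MultRec h × DcBoundedBy h
  dc-bounded t g (_ , rpf) mg = B (3 + K) ∘ (K +_) , B-shift-multRec (3 + K) K , bounded
    where
    j = proj₁ (multRec-majorised mg)
    W = sum (List.map (weight ∘ rhs) rules)
    -- One constant serves as threshold, as level of the base function, and as bound for the rule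
    -- weights, the level majorising `g` and the number of dependency pairs.
    K = 4 + (W + (j + length candidates))

    4≤K : 4 ≤ K
    4≤K = m≤m+n 4 _
    j≤K : j ≤ K
    j≤K = ≤-trans (m≤m+n j _) (m≤n+m _ (4 + W))
    W≤K : 2 + W ≤ K
    W≤K = ≤-trans (m≤n+m _ 2) (m≤m+n (4 + W) _)

    weight≤W : ∀ {ρ} l → ρ ∈ l → weight (rhs ρ) ≤ sum (List.map (weight ∘ rhs) l)
    weight≤W (ρ ∷ l) (here refl) = m≤m+n _ _
    weight≤W (ρ ∷ l) (there i)   = ≤-trans (weight≤W l i) (m≤n+m _ _)

    2≤ : ∀ {x} → K ≤ x → 2 ≤ x
    2≤ le = ≤-trans (m≤m+n 2 _) le
    3≤ : ∀ {x} → K ≤ x → 3 ≤ x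
    3≤ le = ≤-trans (m≤m+n 3 _) le

    open Bound g (B K) K 4≤K
      (λ ρ∈ → ≤-trans (s≤s (s≤s (weight≤W rules ρ∈))) W≤K)
      (B-growing K)
      (λ le → B-double (pred K) (2≤ le))
      (λ {x} le → ≤-trans (proj₂ (multRec-majorised mg) x (≤-trans j≤K le)) (B-mono j≤K (≤-trans (s≤s z≤n) (3≤ le))))

    base : Nice (B K)
    base = nice (B-growing K) (λ _ → ≤-refl)

    H = ⟦ K ⟧ (B K)
    nH = ⟦⟧-nice K base
    gH = Nice.growing nH

    every-call : ∀ s → G H s
    every-call s = Good.calls-bounded
      (proof-tree-good K t rpf (λ _ p → p) IsDP (λ _ p → p)
        (candidates , ≤-trans (m≤n+m _ j) (m≤n+m _ (4 + W)) , IsDP-candidate))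
      base s (λ { _ (call (dp , ¬dp) _) → ⊥-elim (¬dp dp) })

    D-var : ∀ x → D K (var x)
    D-var x k u c = go c refl
      where
      go : ∀ {k s u} → Chain _⟶R_ k s u → s ≡ var x → k + size u ≤ K
      go done refl = ≤-trans (n≤1+n 1) (2≤ ≤-refl)
      go (step (rootStep {fun f ls ⟶ r} ρ∈ σ) c) ()
      go (step (rootStep {var y ⟶ r} ρ∈ σ) c) eq = ⊥-elim (proj₁ (All.lookup wf ρ∈) y refl)

    -- `H` is `T K` applied three times to `suc`, hence the 3.
    H≤B : ∀ {x} → 3 ≤ x → H x ≤ B (suc K) x
    H≤B = T-diag K suc-growing

    H^≤B : ∀ n → H ^[ n ] K ≤ B (suc K) ^[ n ] K
    H^≤B zero    = ≤-refl
    H^≤B (suc n) = ≤-trans (H≤B (3≤ (≤-trans (m≤n+m K n) (^-infl gH n K)))) (mono (B-growing (suc K)) (H^≤B n))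

    bounded : DcBoundedBy (B (3 + K) ∘ (K +_))
    bounded n t size≤ k u c = begin
      k                                   ≤⟨ m≤m+n k _ ⟩
      -- The term is its own instance under `var`, with every variable of cost at most `K`.
      k + size u                          ≤⟨ subst (D _) (sub-var t) (sub-D (λ x _ → D-var x)
                                               (λ {g} {us} _ → every-call (fun g (subs var us))) t ⊵-refl) k u c ⟩
      bnd H K t                           ≤⟨ bnd-≤ gH (double nH) t ⟩
      H ^[ weight t ] K                   ≤⟨ ^-monoˡ gH K weight≤ ⟩
      H ^[ n + n ] K                      ≤⟨ H^≤B (n + n) ⟩
      B (suc K) ^[ n + n ] K              ≤⟨ ^-mono gB (n + n) (m≤m+n K (n + n)) ⟩
      -- The argument is raised to `X` so that it exceeds the number of iterations; one level
      -- absorbs the iterations and one more the doubling of K + n.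
      B (suc K) ^[ n + n ] X              ≤⟨ ^-monoˡ gB X (m≤n⇒m≤1+n (m≤n+m (n + n) K)) ⟩
      B (suc K) ^[ suc X ] X              ≤⟨ B-iterate (suc K) (3≤ (m≤m+n K _)) ⟩
      B (2 + K) X                         ≤⟨ mono gB′ X≤ ⟩
      B (2 + K) ((K + n) + (K + n))       ≤⟨ mono gB′ (B-double (suc K) (2≤ (m≤m+n K n))) ⟩
      B (2 + K) ^[ 2 ] (K + n)            ≤⟨ ^-monoˡ gB′ (K + n) (s≤s (≤-trans (n≤1+n 1) (2≤ (m≤m+n K n)))) ⟩
      B (2 + K) ^[ suc (K + n) ] (K + n)  ≤⟨ B-iterate (2 + K) (3≤ (m≤m+n K n)) ⟩
      B (3 + K) (K + n)                   ∎
      where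
      open ≤-Reasoning
      X = K + (n + n)
      gB = B-growing (suc K)
      gB′ = B-growing (2 + K)
      weight≤ : weight t ≤ n + n
      weight≤ = ≤-trans (n≤1+n _) (≤-trans (weight-size t) (+-mono-≤ size≤ size≤))
      X≤ : X ≤ (K + n) + (K + n)
      X≤ = ≤-trans (≤-reflexive (sym (+-assoc K n n))) (+-monoʳ-≤ (K + n) (m≤n+m n K))

-- A rewrite system computing Ackermann functions

module AckermannRules (k : ℕ) where
  pattern zeroˢ = zero
  pattern sucˢ  = suc zero
  pattern ackˢ  = suc (suc zero)

  arity : Fin 3 → ℕ
  arity zeroˢ = 0
  arity sucˢ  = 1
  arity ackˢ  = 2 + k

  open Terms (Fin 3) arity

  s : Term → Term
  s t = fun sucˢ (t ∷ [])

  A : Vec Term (2 + k) → Term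
  A = fun ackˢ

  vars : Vec Term (2 + k)
  vars = Vec.tabulate (var ∘ toℕ)

  -- Argument 0 is the accumulator, argument suc i the counter of level i (level k being the most significant).
  redex : Fin (suc k) → Vec Term (2 + k)
  redex i = vars [ suc i ]≔ s (var (toℕ (suc i)))

  -- `base` may fire whatever the counters are: a lower bound needs just one long derivation from
  -- each start term.
  base nest : Rule
  base = A vars ⟶ s (var 0)
  nest = A (redex zero) ⟶ A (vars [ zero ]≔ A vars)

  limit : Fin k → Rule
  limit i = A (redex (suc i)) ⟶ A (vars [ suc (inject₁ i) ]≔ var 0)

  ack-rules : List Rule
  ack-rules = base ∷ nest ∷ List.map limit (List.allFin k)

  -- The left-hand sides with a `redex` contain all 2 + k variables, so the variable condition
  -- reduces to a bound on the indices on the right.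
  VarsBound : Term → Set
  VarsBound t = ∀ x → t ⊵ var x → Σ (Fin (2 + k)) λ i → x ≡ toℕ i

  var-bound : ∀ (i : Fin (2 + k)) → VarsBound (var (toℕ i))
  var-bound i _ ⊵-refl = i , refl

  fun-bound : ∀ {f} {ts : Vec Term (arity f)} → (∀ i → VarsBound (lookup ts i)) → VarsBound (fun f ts)
  fun-bound h x (⊵-arg i p) = h i x p

  lookup-vars : ∀ i → lookup vars i ≡ var (toℕ i)
  lookup-vars = lookup∘tabulate (var ∘ toℕ)

  vars-bound : ∀ i → VarsBound (lookup vars i)
  vars-bound i = subst VarsBound (sym (lookup-vars i)) (var-bound i)

  update-bound : ∀ i {t} → VarsBound t → ∀ j → VarsBound (lookup (vars [ i ]≔ t) j)
  update-bound i {t} b j with j Fin.≟ i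
  ... | yes refl = subst VarsBound (sym (lookup∘update i vars t)) b
  ... | no j≢i   = subst VarsBound (sym (lookup∘update′ j≢i vars t)) (vars-bound j)

  redex-vars : ∀ i j → A (redex i) ⊵ var (toℕ j)
  redex-vars i j with j Fin.≟ suc i
  ... | yes refl = ⊵-arg j (subst (_⊵ var (toℕ j)) (sym (lookup∘update j vars (s (var (toℕ j))))) (⊵-arg zero ⊵-refl))
  ... | no j≢i   = ⊵-arg j (subst (_⊵ var (toℕ j)) (sym unchanged) ⊵-refl)
    where
    unchanged : lookup (redex i) j ≡ var (toℕ j)
    unchanged = trans (lookup∘update′ j≢i vars (s (var (toℕ (suc i))))) (lookup-vars j)

  ack-wf : All WellFormed ack-rules
  ack-wf = ((λ _ ()) , λ { x (⊵-arg zero ⊵-refl) → ⊵-arg zero ⊵-refl })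
    ∷ ((λ _ ()) , λ x p → covered zero x (fun-bound (update-bound zero (fun-bound vars-bound)) x p))
    ∷ All.map⁺ (All.tabulate λ {i} _ → (λ _ ()) , λ x p →
        covered (suc i) x (fun-bound (update-bound (suc (inject₁ i)) (var-bound zero)) x p))
    where
    covered : ∀ i x → Σ (Fin (2 + k)) (λ j → x ≡ toℕ j) → A (redex i) ⊵ var x
    covered i x (j , refl) = redex-vars i j

  ack-trs : TRS
  ack-trs = record { N = 3 ; ar = arity ; const = zeroˢ , refl ; rules = ack-rules ; wf = ack-wf }

  infix 4 _⟶R_
  _⟶R_ : Term → Term → Set
  _⟶R_ = Step (_∈ ack-rules)

  z : Term
  z = fun zeroˢ []

  -- `z` is a default for indices beyond the vector; the rules use only the first 2 + k variables.
  assign : ∀ {n} → Vec Term n → Subst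
  assign []       x       = z
  assign (t ∷ ts) zero    = t
  assign (t ∷ ts) (suc x) = assign ts x

  assign-lookup : ∀ {n} (ts : Vec Term n) i → assign ts (toℕ i) ≡ lookup ts i
  assign-lookup (t ∷ ts) zero    = refl
  assign-lookup (t ∷ ts) (suc i) = assign-lookup ts i

  subs-tabulate : ∀ {n} σ (f : Fin n → Term) → subs σ (Vec.tabulate f) ≡ Vec.tabulate (sub σ ∘ f)
  subs-tabulate {zero}  σ f = refl
  subs-tabulate {suc n} σ f = cong (sub σ (f zero) ∷_) (subs-tabulate σ (f ∘ suc))

  subs-update : ∀ {n} σ (ts : Vec Term n) i t → subs σ (ts [ i ]≔ t) ≡ subs σ ts [ i ]≔ sub σ t
  subs-update σ (_ ∷ ts) zero    t = refl
  subs-update σ (u ∷ ts) (suc i) t = cong (sub σ u ∷_) (subs-update σ ts i t)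

  subs-vars : ∀ ts → subs (assign ts) vars ≡ ts
  subs-vars ts = trans (subs-tabulate (assign ts) (var ∘ toℕ))
    (trans (tabulate-cong (assign-lookup ts)) (tabulate∘lookup ts))

  subs-vars-update : ∀ ts i t → subs (assign ts) (vars [ i ]≔ t) ≡ ts [ i ]≔ sub (assign ts) t
  subs-vars-update ts i t = trans (subs-update (assign ts) vars i t) (cong (_[ i ]≔ sub (assign ts) t) (subs-vars ts))

  redex-instance : ∀ ts i → sub (assign ts) (A (redex i)) ≡ A (ts [ suc i ]≔ s (lookup ts (suc i)))
  redex-instance ts i = cong A (trans (subs-vars-update ts (suc i) _)
    (cong (λ t → ts [ suc i ]≔ s t) (assign-lookup ts (suc i))))

  base-step : ∀ t ts → A (t ∷ ts) ⟶R s t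
  base-step t ts = subst (λ us → A us ⟶R s t) (subs-vars (t ∷ ts)) (rootStep (here refl) (assign (t ∷ ts)))

  nest-step : ∀ ts → A (ts [ suc zero ]≔ s (lookup ts (suc zero))) ⟶R A (ts [ zero ]≔ A ts)
  nest-step ts = subst₂ _⟶R_ (redex-instance ts zero)
    (cong A (trans (subs-vars-update ts zero (A vars)) (cong (λ us → ts [ zero ]≔ A us) (subs-vars ts))))
    (rootStep (there (here refl)) (assign ts))

  limit-step : ∀ i ts → A (ts [ suc (suc i) ]≔ s (lookup ts (suc (suc i))))
                     ⟶R A (ts [ suc (inject₁ i) ]≔ lookup ts zero)
  limit-step i ts = subst₂ _⟶R_ (redex-instance ts (suc i))
    (cong A (trans (subs-vars-update ts (suc (inject₁ i)) (var 0))
      (cong (ts [ suc (inject₁ i) ]≔_) (assign-lookup ts zero))))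
    (rootStep (there (there (∈-map⁺ limit (∈-allFin i)))) (assign ts))

  num : ℕ → Term
  num zero    = z
  num (suc n) = s (num n)

  chain-++ : ∀ {m n a b c} → Chain _⟶R_ m a b → Chain _⟶R_ n b c → Chain _⟶R_ (m + n) a c
  chain-++ done       d = d
  chain-++ (step x c) d = step x (chain-++ c d)

  chain-acc : ∀ {m a b} ts → Chain _⟶R_ m a b → Chain _⟶R_ m (A (a ∷ ts)) (A (b ∷ ts))
  chain-acc ts done       = done
  chain-acc ts (step x c) = step (argStep zero x) (chain-acc ts c)

  -- The number of steps is bounded below through the growth of the accumulator.
  Computes : Vec Term (suc k) → (ℕ → ℕ) → Set
  Computes ts f = ∀ y → Σ ℕ λ m → f y ≤ m + y × Chain _⟶R_ m (A (num y ∷ ts)) (num (f y))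

  Computes-suc : ∀ ts → Computes ts suc
  Computes-suc ts y = 1 , ≤-refl , step (base-step (num y) ts) done

  Computes-nest : ∀ t ts {f} → Computes (t ∷ ts) f → Computes (s t ∷ ts) (λ y → f (f y))
  Computes-nest t ts {f} h y with m , le , c ← h y | n , le′ , c′ ← h (f y) =
    suc (m + n) , bound , step (nest-step (num y ∷ t ∷ ts)) (chain-++ (chain-acc (t ∷ ts) c) c′)
    where
    open ≤-Reasoning
    bound : f (f y) ≤ suc (m + n) + y
    bound = begin
      f (f y)            ≤⟨ le′ ⟩
      n + f y            ≤⟨ +-monoʳ-≤ n le ⟩
      n + (m + y)        ≡⟨ +-assoc n m y ⟨
      n + m + y          ≡⟨ cong (_+ y) (+-comm n m) ⟩
      m + n + y          ≤⟨ n≤1+n _ ⟩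
      suc (m + n) + y    ∎

  Computes-limit : ∀ i t ts {f : ℕ → ℕ → ℕ}
    → (∀ n → Computes (ts [ suc i ]≔ t [ inject₁ i ]≔ num n) (f n))
    → Computes (ts [ suc i ]≔ s t) (λ y → f y y)
  Computes-limit i t ts {f} h y with m , le , c ← h y y =
    suc m , ≤-trans le (n≤1+n _) , step limited c
    where
    limited : A (num y ∷ ts [ suc i ]≔ s t) ⟶R A (num y ∷ ts [ suc i ]≔ t [ inject₁ i ]≔ num y)
    limited = subst (λ us → A (num y ∷ us) ⟶R A (num y ∷ ts [ suc i ]≔ t [ inject₁ i ]≔ num y))
      (trans ([]≔-idempotent ts (suc i)) (cong (λ u → ts [ suc i ]≔ s u) (lookup∘update (suc i) ts t)))
      (limit-step i (num y ∷ ts [ suc i ]≔ t))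

  -- The lower counters must be zero: `limit` overwrites the counter just below with the accumulator
  -- n, and counting that one up from zero yields n applications of the lower operator.
  Lifts : Fin (suc k) → Set
  Lifts i = ∀ ts t f → (∀ j → toℕ j < toℕ i → lookup ts j ≡ z)
          → Computes (ts [ i ]≔ t) f → Computes (ts [ i ]≔ s t) (V (toℕ i) f)

  lifts : ∀ i → Lifts i
  lifts = <-weakInduction Lifts
    (λ { (_ ∷ ts) t f _ h → Computes-nest t ts h })
    limit-case
    where
    limit-case : ∀ i → Lifts (inject₁ i) → Lifts (suc i)
    limit-case i lift ts t f zeros h = Computes-limit i t ts {λ n → V (toℕ i) ^[ n ] f} iterated
      where
      us = ts [ suc i ]≔ t
      lower : ∀ j → toℕ j < suc (toℕ i) → lookup us j ≡ z
      lower j j< = trans (lookup∘update′ (λ { refl → <-irrefl refl j< }) ts t) (zeros j j<)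
      iterated : ∀ n → Computes (us [ inject₁ i ]≔ num n) (V (toℕ i) ^[ n ] f)
      iterated zero = subst (λ vs → Computes vs f) (sym (trans
        (cong (us [ inject₁ i ]≔_) (sym (lower (inject₁ i) (≤-reflexive (cong suc (Fin.toℕ-inject₁ i))))))
        ([]≔-lookup us (inject₁ i)))) h
      iterated (suc n) = subst (λ j → Computes (us [ inject₁ i ]≔ num (suc n)) (V j (V (toℕ i) ^[ n ] f)))
        (Fin.toℕ-inject₁ i)
        (lift us (num n) (V (toℕ i) ^[ n ] f)
          (λ j j< → lower j (≤-trans j< (≤-trans (≤-reflexive (Fin.toℕ-inject₁ i)) (n≤1+n _))))
          (iterated n))

  top : Vec Term (suc k)
  top = Vec.replicate (suc k) z [ fromℕ k ]≔ s z

  Computes-top : Computes top (V k suc)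
  Computes-top = subst (λ j → Computes top (V j suc)) (Fin.toℕ-fromℕ k)
    (lifts (fromℕ k) zeros z suc (λ j _ → lookup-replicate j z) (Computes-suc _))
    where zeros = Vec.replicate (suc k) z

  size-num : ∀ n → size (num n) ≡ suc n
  size-num zero    = refl
  size-num (suc n) = cong suc (trans (+-identityʳ _) (size-num n))

  overhead : ℕ
  overhead = 2 + sizes top

  size-start : ∀ y → size (A (num y ∷ top)) ≡ overhead + y
  size-start y = cong suc (trans (cong (_+ sizes top) (size-num y)) (cong suc (+-comm y _)))

-- A proof tree by the subterm criterion

module AckermannTree (k : ℕ) where
  open AckermannRules k
    using (zeroˢ; sucˢ; ackˢ; s; A; vars; redex; base; nest; limit; ack-rules; lookup-vars; ack-trs)
  open DPF ack-trs
  open UpperBound ack-trs using (lookup-embs)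

  rule-root : ∀ {ρ} → ρ ∈ rules → Σ (Vec Term (2 + k)) λ ts → lhs ρ ≡ A ts
  rule-root (here refl)         = _ , refl
  rule-root (there (here refl)) = _ , refl
  rule-root (there (there ρ∈)) with _ , _ , refl ← ∈-map⁻ limit ρ∈ = _ , refl

  defined-ack : ∀ f → Defined f → f ≡ ackˢ
  defined-ack f def = go f (proj₂ (Any.satisfied witness))
    where
    witness : Any.Any (λ _ → True (rootIs f (A vars))) rules
    witness = anyRoot rules rule-root (any⁻ _ rules def)
      where
      anyRoot : ∀ l → (∀ {ρ} → ρ ∈ l → Σ (Vec Term (2 + k)) λ ts → lhs ρ ≡ A ts)
              → Any.Any (λ ρ → True (rootIs f (lhs ρ))) l → Any.Any (λ _ → True (rootIs f (A vars))) l
      anyRoot (ρ ∷ l) r (here p)  = here (subst (λ t → True (rootIs f t)) (proj₂ (r (here refl))) p)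
      anyRoot (ρ ∷ l) r (there p) = there (anyRoot l (r ∘ there) p)
    go : ∀ f → True (rootIs f (A vars)) → f ≡ ackˢ
    go zeroˢ ()
    go sucˢ  ()
    go ackˢ  _ = refl

  -- The shape of a lexicographic decrease: counter `i` loses its `s`, higher counters are kept,
  -- lower ones are arbitrary.
  data AtLevel (i : Fin (suc k)) : Pred♯ where
    at-level : ∀ {us} → (∀ j → toℕ i ≤ toℕ j → lookup us (suc j) ≡ var (toℕ (suc j)))
             → AtLevel i (sharp (A (redex i)) ♯.⟶ sharp (A us))

  Below : ℕ → Pred♯
  Below m ρ = IsDP ρ × Σ (Fin (suc k)) λ i → toℕ i < m × AtLevel i ρ

  var-undefined : ∀ {t u} x → t ≡ var x → t ⊵ u → ¬ DefRoot u
  var-undefined x refl ⊵-refl (_ , _ , () , _)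

  -- Pairs arise only from subterms rooted by `ackˢ`: `nest` has two, both at level 0, and `limit i`
  -- has one, at level i + 1.
  IsDP-level : IsDP ⊆ Below (suc k)
  IsDP-level ρ♯ dp = dp , level dp
    where
    Level : Set
    Level = Σ (Fin (suc k)) λ i → toℕ i < suc k × AtLevel i ρ♯

    level : IsDP ρ♯ → Level
    level (ρ , here refl , u , ⊵-refl , _ , (_ , _ , refl , def) , eq) with () ← defined-ack sucˢ def
    level (ρ , here refl , u , ⊵-arg zero p , _ , def , eq) = ⊥-elim (var-undefined 0 refl p def)
    level (ρ , there (here refl) , u , ⊵-refl , _ , _ , refl) =
      zero , s≤s z≤n , at-level λ j _ → lookup-vars (suc j)
    level (ρ , there (here refl) , u , ⊵-arg zero ⊵-refl , _ , _ , refl) =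
      zero , s≤s z≤n , at-level λ j _ → lookup-vars (suc j)
    level (ρ , there (here refl) , u , ⊵-arg zero (⊵-arg j p) , _ , def , eq) =
      ⊥-elim (var-undefined _ (lookup-vars j) p def)
    level (ρ , there (here refl) , u , ⊵-arg (suc j) p , _ , def , eq) =
      ⊥-elim (var-undefined _ (lookup-vars (suc j)) p def)
    level (ρ , there (there ρ∈) , u , p , q , def , eq) with i , _ , refl ← ∈-map⁻ limit ρ∈ = at-limit i p def eq
      where
      at-limit : ∀ i {u} → rhs (limit i) ⊵ u → DefRoot u → ρ♯ ≡ (sharp (lhs (limit i)) ♯.⟶ sharp u) → Level
      at-limit i ⊵-refl _ refl = suc i , Fin.toℕ<n (suc i) , at-level λ j i<j →
        trans (lookup∘update′ {i = suc j} {suc (inject₁ i)}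
                (λ { refl → <-irrefl (sym (Fin.toℕ-inject₁ i)) i<j }) vars (var 0))
              (lookup-vars (suc j))
      at-limit i (⊵-arg j p) def eq with j Fin.≟ suc (inject₁ i)
      ... | yes refl = ⊥-elim (var-undefined 0 (lookup∘update j vars (var 0)) p def)
      ... | no j≢    = ⊥-elim (var-undefined _ (trans (lookup∘update′ j≢ vars (var 0)) (lookup-vars j)) p def)

  project : Fin (suc k) → Projection
  project c zeroˢ def with () ← defined-ack zeroˢ def
  -- A default value, as `ackˢ` is the only defined symbol.
  project c sucˢ  def = zero
  project c ackˢ  def = suc c

  ProjOf-ack : ∀ c ts {a} → ProjOf (project c) (sharp (A ts)) a → a ≡ emb (lookup ts (suc c))
  ProjOf-ack c ts (_ , _ , refl , def , eq) = trans eq (lookup-embs ts (suc c))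

  rhs-proj : ∀ {i ρ} c → AtLevel i ρ → toℕ i ≤ toℕ c
           → ∀ {b} → ProjOf (project c) (♯.rhs ρ) b → b ≡ ♯.var (toℕ (suc c))
  rhs-proj c (at-level {us} kept) i≤c pr = trans (ProjOf-ack c us pr) (cong emb (kept c i≤c))

  lhs-proj-kept : ∀ {i ρ} c → AtLevel i ρ → toℕ i < toℕ c
                → ∀ {a} → ProjOf (project c) (♯.lhs ρ) a → a ≡ ♯.var (toℕ (suc c))
  lhs-proj-kept {i} c (at-level _) i<c pr = trans (ProjOf-ack c (redex i) pr)
    (cong emb (trans (lookup∘update′ {i = suc c} {suc i} (λ { refl → <-irrefl refl i<c })
                       vars (s (var (toℕ (suc i)))))
                     (lookup-vars (suc c))))

  lhs-proj-suc : ∀ {ρ} c → AtLevel c ρ → ∀ {a} → ProjOf (project c) (♯.lhs ρ) a → a ≡ emb (s (var (toℕ (suc c))))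
  lhs-proj-suc c (at-level _) pr = trans (ProjOf-ack c (redex c) pr)
    (cong emb (lookup∘update (suc c) vars (s (var (toℕ (suc c))))))

  -- The most significant counter goes first: projecting to it is strict on its own level and
  -- constant on all lower ones.
  below-tree : ∀ m → m ≤ suc k → ∀ {P} → P ⊆ Below m → PT P
  below-tree zero    _  h = leaf λ ρ p → no-level (proj₂ (h ρ p))
    where
    no-level : ∀ {X : Fin (suc k) → Set} → ¬ (Σ (Fin (suc k)) λ i → toℕ i < 0 × X i)
    no-level (_ , () , _)
  below-tree (suc m) le {P} h =
    scStep (project c) (Below m) (λ _ → proj₁) weak strict (below-tree m (<⇒≤ le) (λ _ b → b))
    where
    c : Fin (suc k)
    c = fromℕ< le
    c≡m : toℕ c ≡ m
    c≡m = Fin.toℕ-fromℕ< le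
    weak : ∀ ρ → Below m ρ → ∀ a b → ProjOf (project c) (♯.lhs ρ) a → ProjOf (project c) (♯.rhs ρ) b → a ♯.⊵ b
    weak ρ (_ , i , i<m , l) a b pa pb = subst₂ ♯._⊵_
      (sym (lhs-proj-kept c l (≤-trans i<m (≤-reflexive (sym c≡m))) pa))
      (sym (rhs-proj c l (≤-trans (<⇒≤ i<m) (≤-reflexive (sym c≡m))) pb)) ♯.⊵-refl
    strict : ∀ ρ → (P ∖ Below m) ρ
           → ∀ a b → ProjOf (project c) (♯.lhs ρ) a → ProjOf (project c) (♯.rhs ρ) b → a ♯.▷ b
    strict ρ (p , ¬b) a b pa pb with dp , i , i<sm , l ← h ρ p with i Fin.≟ c
    ... | yes refl = subst₂ ♯._▷_ (sym (lhs-proj-suc c l pa)) (sym (rhs-proj c l ≤-refl pb)) (♯.▷-arg zero ♯.⊵-refl)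
    ... | no i≢c   = ⊥-elim (¬b (dp , i ,
                       ≤∧≢⇒< (s≤s⁻¹ i<sm) (λ eq → i≢c (Fin.toℕ-injective (trans eq (sym c≡m)))) , l))

  below-rpf : ∀ g m (le : m ≤ suc k) {P} (h : P ⊆ Below m) → IsRPF g (below-tree m le h)
  below-rpf g zero    le h = fLeaf
  below-rpf g (suc m) le h = fSC (below-rpf g m (<⇒≤ le) (λ _ b → b))

  ack-tree : ProofTree
  ack-tree = below-tree (suc k) ≤-refl IsDP-level

  ack-rpf : ∀ g → IsRPF g ack-tree
  ack-rpf g = below-rpf g (suc k) ≤-refl IsDP-level

-- Majorising a given multiply recursive function

B-twice : ∀ i {x} → 3 ≤ x → B i (B i x) ≤ B (suc i) x
B-twice i {x} 3≤x = ≤-trans (^-monoˡ (B-growing i) x (m≤n⇒m≤1+n (≤-trans (n≤1+n 2) 3≤x))) (B-iterate i 3≤x)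

dc-majorises : ∀ f → MultRec f → Σ TRS λ S → Σ (DPF.ProofTree S) λ t → Σ (ℕ → ℕ) λ g →
               DPF.ReductionPairFunction S t g × MultRec g × DPF.DcMajorises S f
dc-majorises f mf with j , f≤B ← multRec-majorised mf =
  ack-trs , ack-tree , (λ _ → 0) , ((λ _ _ _ → z≤n) , ack-rpf _) , (zeroF 1 , λ _ → ezero) ,
  overhead + (overhead + (3 + j)) , witness
  where
  -- Three levels absorb the sum and the size overhead in `large`; the fourth is the passage from
  -- `T` to `V`.
  k = 4 + j
  open AckermannRules k
  open AckermannTree k using (ack-tree; ack-rpf)

  -- The summand `y` offsets the initial accumulator, which `Computes` does not count as steps.
  large : ∀ y → overhead + (3 + j) ≤ y → f (overhead + y) + y ≤ V k suc y
  large y le = begin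
    f n + y                      ≤⟨ +-mono-≤ (f≤B n (≤-trans j≤y y≤n)) (≤-trans y≤n (<⇒≤ (infl (B-growing j) n))) ⟩
    B j n + B j n                ≤⟨ B-double j (≤-trans (n≤1+n 2) (≤-trans 3≤n (<⇒≤ (infl (B-growing j) n)))) ⟩
    B (suc j) (B j n)            ≤⟨ mono (B-growing (suc j)) (B-mono (n≤1+n j) (≤-trans (s≤s z≤n) 3≤n)) ⟩
    B (suc j) (B (suc j) n)      ≤⟨ B-twice (suc j) 3≤n ⟩
    B (2 + j) n                  ≤⟨ mono (B-growing (2 + j)) n≤ ⟩
    B (2 + j) (B (2 + j) y)      ≤⟨ B-twice (2 + j) 3≤y ⟩
    B (3 + j) y                  ≤⟨ T≤V (3 + j) suc-growing suc-growing (λ _ → ≤-refl) (≤-trans (s≤s z≤n) 3≤y) ⟩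
    V k suc y                    ∎
    where
    open ≤-Reasoning
    n = overhead + y
    y≤n = m≤n+m y overhead
    o≤y = ≤-trans (m≤m+n overhead _) le
    3≤y = ≤-trans (m≤m+n 3 j) (≤-trans (m≤n+m _ overhead) le)
    j≤y = ≤-trans (m≤n+m j 3) (≤-trans (m≤n+m _ overhead) le)
    3≤n = ≤-trans 3≤y y≤n
    n≤ : n ≤ B (2 + j) y
    n≤ = ≤-trans (+-monoˡ-≤ y o≤y) (B-double (suc j) (≤-trans (n≤1+n 2) 3≤y))

  open Terms (Fin 3) arity using (Term; size)

  witness : ∀ n → overhead + (overhead + (3 + j)) ≤ n
          → Σ Term λ t → (size t ≤ n) × Σ ℕ λ m → (f n ≤ m) × Σ Term λ u → Chain _⟶R_ m t u
  witness n le with y , refl ← m≤n⇒∃[o]m+o≡n (≤-trans (m≤m+n overhead _) le) with m , V≤ , c ← Computes-top y =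
    A (num y ∷ top) , ≤-reflexive (size-start y) , m ,
    +-cancelʳ-≤ y _ _ (≤-trans (large y (+-cancelˡ-≤ overhead _ _ le)) V≤) , num (V k suc y) , c

theorem2 : ((S : TRS) (T : DPF.ProofTree S) (g : ℕ → ℕ)
    → DPF.ReductionPairFunction S T g → MultRec g
    → Σ (ℕ → ℕ) λ h → MultRec h × DPF.DcBoundedBy S h)
    × ((f : ℕ → ℕ) → MultRec f
    → Σ TRS λ S' → Σ (DPF.ProofTree S') λ T' → Σ (ℕ → ℕ) λ g' →
    DPF.ReductionPairFunction S' T' g' × MultRec g' × DPF.DcMajorises S' f)
theorem2 = (λ S → UpperBound.dc-bounded S) , dc-majorises
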